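{- Let $m\geq2$ and let $P$ be a finite nonempty set of primes. For every $p\in P$: if $n$ is a $P$-number which is $m$-Carmichael, then $p^{v_{m,P}(p)}\,n$ is also a $P$-number which is $m$-Carmichael; i.e. the set of $P$-numbers which are $m$-Carmichael is invariant under multiplication by $p^{v_{m,P}(p)}$.
   Context: For $k\geq1$, $\Phi_k(X)$ denotes the $k$th cyclotomic polynomial. For $n\in\mathbb N$ set $D_m(n)=\prod_{j=1}^m\Phi_j(n)$, $\nabla_m(n)=\prod_{q\mid n}q^{\lceil\log_q m\rceil-1}$ (product over prime divisors $q$ of $n$), and $K_m(n)=n\,\nabla_m(n)\,D_m(n)$. A composite $n\in\mathbb N$ is called $m$-Carmichael if $A^{K_m(n)}=I$ for all $A\in\mathrm{GL}(m,\mathbb Z/n\mathbb Z)$. A $P$-number is an $n\in\mathbb N$ whose set of prime divisors is exactly $P$. Let $D_m(P)=\mathrm{lcm}\{D_m(q):q\in P\}$, and write $D_m(P)=D_m'(P)D_m''(P)$ where $D_m'(P)$ is a product of primes in $P$ and $D_m''(P)$ is coprime to every prime in $P$. For $p\in P$, $v_{m,P}(p)$ denotes the multiplicative order of $p$ modulo $D_m''(P)$ in $(\mathbb Z/D_m''(P)\mathbb Z)^\times$. -}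

module Defs where

open import Data.Nat using (ℕ; zero; suc; _+_; _*_; _∸_; _^_; _≤_; _<_; _≤?_; NonZero)
open import Data.Nat.Divisibility using (_∣_; _∣?_)
open import Data.Nat.DivMod using (_/_)
open import Data.Nat.LCM using (lcm)
open import Data.Nat.Primality using (Prime; prime?)
open import Data.List using (List; []; _∷_; _++_; foldr; map; filter; upTo; reverse)
open import Data.List.Membership.Propositional using (_∈_)
open import Data.Fin using (Fin)
open import Data.Integer as ℤ using (ℤ; +_)
import Data.Integer.Divisibility as ℤD
open import Data.Product using (Σ; _×_; _,_; ∃)
open import Relation.Nullary using (¬_; yes; no)
open import Relation.Binary.PropositionalEquality using (_≡_)
open import Function.Bundles using (_⇔_)

prodℕ : List ℕ → ℕ
prodℕ = foldr _*_ 1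

oneTo : ℕ → List ℕ
oneTo k = map suc (upTo k)

-- division returning 0 when dividing by 0 (never used with divisor 0 below
-- for arguments n ≥ 2)
divℕ : ℕ → ℕ → ℕ
divℕ a zero    = 0
divℕ a (suc b) = a / suc b

-- Cyclotomic values Φ_k(n), for n ≥ 2, via  n^k - 1 = ∏_{d ∣ k} Φ_d(n).
-- cycloList n k = [Φ_1(n), ..., Φ_k(n)]

private
  properDivVals : ℕ → List ℕ → List ℕ
  properDivVals k vals = go 1 vals
    where
    go : ℕ → List ℕ → List ℕ
    go d []       = []
    go d (v ∷ vs) with d ∣? k
    ... | yes _ = v ∷ go (suc d) vs
    ... | no  _ = go (suc d) vs

cycloList : ℕ → ℕ → List ℕ
cycloList n zero    = []
cycloList n (suc k) =
  let prev = cycloList n k in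
  prev ++ (divℕ (n ^ suc k ∸ 1) (prodℕ (properDivVals (suc k) prev)) ∷ [])

Dm : ℕ → ℕ → ℕ
Dm m n = prodℕ (cycloList n m)

-- ⌈log_q m⌉ : least e with m ≤ q^e (searched in 0..m, enough for q ≥ 2)

ceilLog : ℕ → ℕ → ℕ
ceilLog q m = go 0 (suc m)
  where
  go : ℕ → ℕ → ℕ
  go e zero     = e
  go e (suc f) with m ≤? q ^ e
  ... | yes _ = e
  ... | no  _ = go (suc e) f

primeDivisors : ℕ → List ℕ
primeDivisors n = filter (λ q → q ∣? n) (filter prime? (oneTo n))

nabla : ℕ → ℕ → ℕ
nabla m n = prodℕ (map (λ q → q ^ (ceilLog q m ∸ 1)) (primeDivisors n))

Km : ℕ → ℕ → ℕ
Km m n = n * nabla m n * Dm m n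

-- Matrices over ℤ/nℤ, represented by integer matrices up to congruence

Mat : ℕ → Set
Mat m = Fin m → Fin m → ℤ

sumFin : ∀ m → (Fin m → ℤ) → ℤ
sumFin zero    f = + 0
sumFin (suc m) f = f Fin.zero ℤ.+ sumFin m (λ i → f (Fin.suc i))
  where import Data.Fin as Fin

_⊗_ : ∀ {m} → Mat m → Mat m → Mat m
_⊗_ {m} A B i j = sumFin m (λ k → A i k ℤ.* B k j)

idMat : ∀ {m} → Mat m
idMat i j with i Data.Fin.≟ j
  where import Data.Fin
... | yes _ = + 1
... | no  _ = + 0

matPow : ∀ {m} → Mat m → ℕ → Mat m
matPow A zero    = idMat
matPow A (suc k) = A ⊗ matPow A k

_≡[mod_]_ : ∀ {m} → Mat m → ℕ → Mat m → Set
A ≡[mod n ] B = ∀ i j → (+ n) ℤD.∣ (A i j ℤ.- B i j)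

InGL : (m n : ℕ) → Mat m → Set
InGL m n A = Σ (Mat m) λ B → ((A ⊗ B) ≡[mod n ] idMat) × ((B ⊗ A) ≡[mod n ] idMat)

Carmichael : ℕ → ℕ → Set
Carmichael m n =
  Data.Nat.Primality.Composite n ×
  (∀ (A : Mat m) → InGL m n A → matPow A (Km m n) ≡[mod n ] idMat)
  where import Data.Nat.Primality

IsPNumber : List ℕ → ℕ → Set
IsPNumber P n = 1 ≤ n × (∀ q → (Prime q × q ∣ n) ⇔ q ∈ P)

DmP : ℕ → List ℕ → ℕ
DmP m P = foldr (λ q acc → lcm (Dm m q) acc) 1 P

-- remove all factors q from x (fuel-bounded; fuel x suffices for q ≥ 2)
stripFactor : ℕ → ℕ → ℕ
stripFactor q x = go x x
  where
  go : ℕ → ℕ → ℕ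
  go zero    y = y
  go (suc f) y with q ∣? y
  ... | yes _ = go f (divℕ y q)
  ... | no  _ = y

DmP'' : ℕ → List ℕ → ℕ
DmP'' m P = foldr stripFactor (DmP m P) P

-- multiplicative order of p modulo d (d ≥ 1, gcd(p,d) = 1):
-- least k ≥ 1 with d ∣ p^k - 1, searched in 1..d
multOrder : ℕ → ℕ → ℕ
multOrder p d = go 1 d
  where
  go : ℕ → ℕ → ℕ
  go k zero    = k
  go k (suc f) with d ∣? (p ^ k ∸ 1)
  ... | yes _ = k
  ... | no  _ = go (suc k) f

vmP : ℕ → List ℕ → ℕ → ℕ
vmP m P p = multOrder p (DmP'' m P)

{-# OPTIONS --safe #-}
module Submission where

-- Put N = p^v n. Raising A^K(n) ≡ I (mod n) to the power p^v gives A^(p^v K(n)) ≡ I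
-- (mod N), while every A ∈ GL(m, ℤ/N) satisfies A^(N^t D″) ≡ I (mod N) for some t.
-- Hence A^g ≡ I for the gcd g of the two exponents. As D_m(n) is coprime to N, g divides
-- N ∇(n) gcd(D_m(n), D″), and p^v ≡ 1 (mod D″) makes gcd(D_m(n), D″) divide D_m(N), so g ∣ K(N).
--
-- All that is needed about D_m(n) follows from D_m(n) = lcm (n^i − 1 : 1 ≤ i ≤ m), which
-- holds because n^i − 1 is a strong divisibility sequence.
--
-- For the second exponent, let q be a prime divisor of N. By pigeonhole a nonzero f ∈ 𝔽_q[X] of
-- degree ≤ m kills a given vector u. In the commutative ring 𝔽_q[X]/Ann(u) Frobenius makes every
-- X^(q^i) a root of f; dividing f successively by these roots shows that X^(D_m(q) q^m) − 1 is
-- nilpotent, and Frobenius turns this into X^(D_m(q) q^(2m)) = 1.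

-- There is no reason for D_m(n) to divide D_m(N), so the exponent known for n cannot simply be
-- enlarged to K(N). The second exponent discards the part of D_m(n) not shared with D″, and on the
-- shared part p^v ≡ 1 makes n and N indistinguishable. That exponent may be very crude: a factor
-- N^t is coprime to D_m(n) and vanishes in the gcd, so neither t nor the powers of q in the bound
-- modulo q have to be sharp. The ring 𝔽_q[X]/Ann(u) is commutative but may have zero divisors and
-- nilpotents, so a polynomial of degree ≤ m with the m + 1 roots X, X^q, ..., X^(q^m) is no
-- contradiction. What replaces the distinctness of roots is that, for y = X^(D_m(q) q^m), the
-- element y - 1 kills everything on which two of these roots agree. Each division by a root
-- therefore costs one factor y - 1, and in the end a power of y - 1 kills a nonzero scalar, hence
-- is zero.

-- Divisibility, gcds and primes in the natural numbers.

module Arithmetic where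

  open import Data.Empty using (⊥-elim)
  open import Data.Nat
  open import Data.Nat.Combinatorics using (_C_; nCk≡n!/k![n-k]!; k![n∸k]!∣n!)
  open import Data.Nat.Coprimality using (Coprime; coprime-divisor)
  open import Data.Nat.DivMod using (_/_; _%_; m≡m%n+[m/n]*n; m/n*n≡m)
  open import Data.Nat.Divisibility
  open import Data.Nat.GCD
  open import Data.Nat.LCM using (lcm; gcd*lcm)
  open import Data.Nat.Primality using (Prime; euclidsLemma; prime⇒nonTrivial)
  open import Data.Nat.Properties
  open import Data.Product using (_,_)
  open import Data.Sum using (inj₁; inj₂)
  open import Relation.Binary.PropositionalEquality
  open import Relation.Nullary using (¬_)

  ∣-gcd-*ʳ : ∀ {z} a b c → z ∣ a * c → z ∣ b * c → z ∣ gcd a b * c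
  ∣-gcd-*ʳ {z} a b c za zb = subst (z ∣_)
    (trans (sym (c*gcd[m,n]≡gcd[cm,cn] c a b)) (*-comm c (gcd a b)))
    (gcd-greatest (subst (z ∣_) (*-comm a c) za) (subst (z ∣_) (*-comm b c) zb))

  gcd-cofactors : ∀ {e x y} x′ y′ → e ≢ 0 → x ≡ x′ * e → y ≡ y′ * e → gcd x y ∣ e → gcd x′ y′ ≡ 1
  gcd-cofactors {e} x′ y′ e≢0 refl refl g∣e = ∣1⇒≡1 (*-cancelʳ-∣ e {{≢-nonZero e≢0}} (subst₂ _∣_ eq (sym (*-identityˡ e)) g∣e))
    where
    eq : gcd (x′ * e) (y′ * e) ≡ gcd x′ y′ * e
    eq = trans (cong₂ gcd (*-comm x′ e) (*-comm y′ e))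
           (trans (sym (c*gcd[m,n]≡gcd[cm,cn] e x′ y′)) (*-comm e _))

  -- Both Y · XZ and W · XZ are multiples of g, so the coprimality of Y and W yields g ∣ XZ. In the
  -- application W is the power of N that has to disappear.
  ∣*∧∣*⇒∣*gcd : ∀ {g} X Y Z W → gcd Y W ≡ 1 → g ∣ X * Y → g ∣ W * Z → g ∣ X * gcd Y Z
  ∣*∧∣*⇒∣*gcd {g} X Y Z W coprime g∣XY g∣WZ = subst (g ∣_) (sym (c*gcd[m,n]≡gcd[cm,cn] X Y Z))
    (gcd-greatest g∣XY (subst (g ∣_) (trans (cong (_* (X * Z)) coprime) (*-identityˡ (X * Z)))
      (∣-gcd-*ʳ Y W (X * Z) g∣Y[XZ] g∣W[XZ])))
    where
    g∣Y[XZ] : g ∣ Y * (X * Z)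
    g∣Y[XZ] = subst (g ∣_) (trans (cong (_* Z) (*-comm X Y)) (*-assoc Y X Z)) (∣m⇒∣m*n Z g∣XY)
    g∣W[XZ] : g ∣ W * (X * Z)
    g∣W[XZ] = subst (g ∣_) (trans (sym (*-assoc X W Z)) (trans (cong (_* Z) (*-comm X W)) (*-assoc W X Z))) (∣n⇒∣m*n X g∣WZ)

  lcm≢0 : ∀ {x y} → x ≢ 0 → y ≢ 0 → lcm x y ≢ 0
  lcm≢0 {x} {y} x≢0 y≢0 eq with m*n≡0⇒m≡0∨n≡0 x
    (trans (sym (gcd*lcm x y)) (trans (cong (gcd x y *_) eq) (*-zeroʳ (gcd x y))))
  ... | inj₁ x≡0 = x≢0 x≡0
  ... | inj₂ y≡0 = y≢0 y≡0

  x*y∸1≡ : ∀ x {y} → 1 ≤ y → x * y ∸ 1 ≡ x * (y ∸ 1) + (x ∸ 1)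
  x*y∸1≡ zero    (s≤s _) = refl
  x*y∸1≡ (suc x) {suc y} _ = begin
    suc x * suc y ∸ 1         ≡⟨ cong (_∸ 1) (*-suc (suc x) y) ⟩
    suc x + suc x * y ∸ 1     ≡⟨⟩
    x + suc x * y             ≡⟨ +-comm x _ ⟩
    suc x * y + x             ∎
    where open ≡-Reasoning

  ∣∸1-* : ∀ {z} x {y} → 1 ≤ y → z ∣ x ∸ 1 → z ∣ y ∸ 1 → z ∣ x * y ∸ 1
  ∣∸1-* {z} x 1≤y zx zy = subst (z ∣_) (sym (x*y∸1≡ x 1≤y)) (∣m∣n⇒∣m+n (∣n⇒∣m*n x zy) zx)

  ∣∸1-cancel : ∀ {z} x {y} → 1 ≤ y → z ∣ x * y ∸ 1 → z ∣ y ∸ 1 → z ∣ x ∸ 1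
  ∣∸1-cancel {z} x 1≤y zxy zy = ∣m+n∣m⇒∣n (subst (z ∣_) (x*y∸1≡ x 1≤y) zxy) (∣n⇒∣m*n x zy)

  1≤^ : ∀ {n} k → 1 ≤ n → 1 ≤ n ^ k
  1≤^ {n} k 1≤n = >-nonZero⁻¹ _ {{m^n≢0 n k {{>-nonZero 1≤n}}}}

  ∣∸1-^ : ∀ {z x} → 1 ≤ x → ∀ k → z ∣ x ∸ 1 → z ∣ x ^ k ∸ 1
  ∣∸1-^ 1≤x zero    _  = _ ∣0
  ∣∸1-^ {x = x} 1≤x (suc k) zx = ∣∸1-* x (1≤^ k 1≤x) zx (∣∸1-^ 1≤x k zx)

  pow∸1-mono : ∀ {n} → 1 ≤ n → ∀ {i j} → i ∣ j → n ^ i ∸ 1 ∣ n ^ j ∸ 1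
  pow∸1-mono {n} 1≤n {i} (divides-refl q) =
    subst (λ t → n ^ i ∸ 1 ∣ t ∸ 1) (trans (^-*-assoc n i q) (cong (n ^_) (*-comm i q)))
      (∣∸1-^ (1≤^ i 1≤n) q ∣-refl)

  -- Bézout over ℕ gives gcd i j + y j = x i, or the same with i and j exchanged. Modulo z both n^(x
  -- i) and n^(y j) are 1, which leaves n^(gcd i j) ≡ 1.
  pow∸1-gcd : ∀ {n} → 1 ≤ n → ∀ {z} i j → z ∣ n ^ i ∸ 1 → z ∣ n ^ j ∸ 1 → z ∣ n ^ gcd i j ∸ 1
  pow∸1-gcd {n} 1≤n {z} i j zi zj with Bézout.identity (gcd-GCD i j)
  ... | Bézout.+- x y eq = ∣∸1-cancel (n ^ gcd i j) (1≤^ (y * j) 1≤n)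
          (subst (λ t → z ∣ t ∸ 1) (trans (cong (n ^_) (sym eq)) (^-distribˡ-+-* n (gcd i j) (y * j)))
            (∣-trans zi (pow∸1-mono 1≤n (n∣m*n x))))
          (∣-trans zj (pow∸1-mono 1≤n (n∣m*n y)))
  ... | Bézout.-+ x y eq = ∣∸1-cancel (n ^ gcd i j) (1≤^ (x * i) 1≤n)
          (subst (λ t → z ∣ t ∸ 1) (trans (cong (n ^_) (sym eq)) (^-distribˡ-+-* n (gcd i j) (x * i)))
            (∣-trans zj (pow∸1-mono 1≤n (n∣m*n y))))
          (∣-trans zi (pow∸1-mono 1≤n (n∣m*n x)))

  ^-mono-∣ : ∀ {a b} → a ∣ b → ∀ k → a ^ k ∣ b ^ k
  ^-mono-∣ a∣b zero    = ∣-refl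
  ^-mono-∣ a∣b (suc k) = *-pres-∣ a∣b (^-mono-∣ a∣b k)

  ≤⇒^∣^ : ∀ q {i j} → i ≤ j → q ^ i ∣ q ^ j
  ≤⇒^∣^ q {i} {j} i≤j = subst (q ^ i ∣_)
    (trans (sym (^-distribˡ-+-* q i (j ∸ i))) (cong (q ^_) (m+[n∸m]≡n i≤j)))
    (m∣m*n (q ^ (j ∸ i)))

  ^-distribʳ-* : ∀ k a b → (a * b) ^ k ≡ a ^ k * b ^ k
  ^-distribʳ-* zero    a b = refl
  ^-distribʳ-* (suc k) a b = trans (cong (a * b *_) (^-distribʳ-* k a b)) ([m*n]*[o*p]≡[m*o]*[n*p] a b (a ^ k) (b ^ k))

  prime⇒2≤ : ∀ {q} → Prime q → 2 ≤ q
  prime⇒2≤ pr = nonTrivial⇒n>1 _ {{prime⇒nonTrivial pr}}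

  n≤q^n : ∀ {q} → 2 ≤ q → ∀ n → n ≤ q ^ n
  n≤q^n 2≤q zero    = z≤n
  n≤q^n {q} 2≤q (suc n) = begin
    1 + n              ≤⟨ +-mono-≤ (1≤^ n (≤-trans (s≤s z≤n) 2≤q)) (n≤q^n 2≤q n) ⟩
    q ^ n + q ^ n      ≡⟨ cong (q ^ n +_) (sym (+-identityʳ _)) ⟩
    2 * q ^ n          ≤⟨ *-monoˡ-≤ (q ^ n) 2≤q ⟩
    q * q ^ n          ∎
    where open ≤-Reasoning

  prime∤! : ∀ {q} → Prime q → ∀ k → k < q → ¬ q ∣ k !
  prime∤! pr zero    _   q∣ = <⇒≱ (prime⇒2≤ pr) (∣⇒≤ q∣)
  prime∤! pr (suc k) k<q q∣ with euclidsLemma (suc k) (k !) pr q∣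
  ... | inj₁ q∣k = <⇒≱ k<q (∣⇒≤ q∣k)
  ... | inj₂ q∣k! = prime∤! pr k (<-trans (n<1+n k) k<q) q∣k!

  -- The prime divides q! = (q C k) · k! (q - k)! but neither of the two factorials of smaller
  -- numbers.
  prime∣C : ∀ {q} → Prime q → ∀ {k} → 0 < k → k < q → q ∣ q C k
  prime∣C {q@(suc q-1)} pr {k} 0<k k<q with euclidsLemma (q C k) (k ! * (q ∸ k) !) pr q∣
    where
    instance
      _ = k !* (q ∸ k) !≢0
    q∣ : q ∣ (q C k) * (k ! * (q ∸ k) !)
    q∣ = subst (q ∣_) (trans (sym (m/n*n≡m (k![n∸k]!∣n! (<⇒≤ k<q))))
           (cong (_* (k ! * (q ∸ k) !)) (sym (nCk≡n!/k![n-k]! (<⇒≤ k<q)))))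
           (m∣m*n (q-1 !))
  ... | inj₁ q∣C = q∣C
  ... | inj₂ q∣d with euclidsLemma (k !) ((q ∸ k) !) pr q∣d
  ... | inj₁ h = ⊥-elim (prime∤! pr k k<q h)
  ... | inj₂ h = ⊥-elim (prime∤! pr (q ∸ k) (∸-monoʳ-< 0<k (<⇒≤ k<q)) h)

  prime-∣-^ : ∀ {q p} → Prime q → ∀ k → q ∣ p ^ k → q ∣ p
  prime-∣-^ pr zero    q∣ = ⊥-elim (<⇒≱ (prime⇒2≤ pr) (∣⇒≤ q∣))
  prime-∣-^ {p = p} pr (suc k) q∣ with euclidsLemma p (p ^ k) pr q∣
  ... | inj₁ q∣p = q∣p
  ... | inj₂ q∣pᵏ = prime-∣-^ pr k q∣pᵏ

  coprime-^-∣ : ∀ {D p} → Coprime D p → ∀ k {x} → D ∣ p ^ k * x → D ∣ x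
  coprime-^-∣ c zero    {x} h = subst (_ ∣_) (*-identityˡ x) h
  coprime-^-∣ {D} {p} c (suc k) {x} h = coprime-^-∣ c k (coprime-divisor c (subst (D ∣_) (*-assoc p (p ^ k) x) h))

  ∣^∧coprime⇒≡1 : ∀ {N z} → (∀ {d} → d ∣ z → d ∣ N → d ≡ 1) → ∀ s → z ∣ N ^ s → z ≡ 1
  ∣^∧coprime⇒≡1 c zero    z∣ = ∣1⇒≡1 z∣
  ∣^∧coprime⇒≡1 c (suc s) z∣ = ∣^∧coprime⇒≡1 c s (coprime-divisor (λ (d∣z , d∣N) → c d∣z d∣N) z∣)

  %-≡⇒∣∸ : ∀ a b D .{{_ : NonZero D}} → a % D ≡ b % D → D ∣ b ∸ a
  %-≡⇒∣∸ a b D eq = subst (D ∣_) (sym b∸a≡) (divides (b / D ∸ a / D) (sym (*-distribʳ-∸ D (b / D) (a / D))))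
    where
    b∸a≡ : b ∸ a ≡ (b / D) * D ∸ (a / D) * D
    b∸a≡ = trans (cong₂ _∸_ (m≡m%n+[m/n]*n b D) (trans (m≡m%n+[m/n]*n a D) (cong (_+ (a / D) * D) eq)))
                 ([m+n]∸[m+o]≡n∸o (b % D) _ _)

-- Strong divisibility sequences and the cyclotomic product.

module Cyclotomics where

  open import Data.Empty using (⊥-elim)
  open import Data.List using (List; []; _∷_; _++_; length)
  open import Data.List.Membership.Propositional using (_∈_)
  open import Data.List.Properties using (length-++)
  open import Data.List.Relation.Unary.All using (All; []; _∷_)
  open import Data.List.Relation.Unary.Any using (here; there)
  open import Data.Nat
  open import Data.Nat.Divisibility
  open import Data.Nat.DivMod using (m/n*n≡m)
  open import Data.Nat.GCD
  open import Data.Nat.LCM using (m∣lcm[m,n]; n∣lcm[m,n])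
  open import Data.Nat.Primality using (Prime)
  open import Data.Nat.Properties
  open import Data.Sum using (inj₁; inj₂)
  open import Data.Unit using (⊤; tt)
  open import Level using (0ℓ)
  open import Relation.Binary.PropositionalEquality
  open import Relation.Nullary using (¬_; yes; no)
  open import Relation.Unary using (Pred; Decidable)
  open import Defs
  open Arithmetic

  divℕ-exact : ∀ {a e} → e ≢ 0 → e ∣ a → a ≡ divℕ a e * e
  divℕ-exact {a} {zero} e≢0 _ = ⊥-elim (e≢0 refl)
  divℕ-exact {a} {suc e} _ e∣a = sym (m/n*n≡m e∣a)

  -- The field least combines minimality (take z = x) with the distributivity of gcd over lcm.
  record IsLcm (a : ℕ → ℕ) (S : Pred ℕ 0ℓ) (k x : ℕ) : Set where
    field
      nonzero : x ≢ 0
      upper   : ∀ {i} → 1 ≤ i → i ≤ k → S i → a i ∣ x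
      least   : ∀ {z E} → z ∣ x → (∀ {i} → 1 ≤ i → i ≤ k → S i → gcd (a i) z ∣ E) → z ∣ E

  module StrongDivisibility
    (a : ℕ → ℕ)
    (a≢0 : ∀ k → a (suc k) ≢ 0)
    (a-mono : ∀ {i j} → i ∣ j → a i ∣ a j)
    (a-gcd : ∀ {z} i j → z ∣ a i → z ∣ a j → z ∣ a (gcd i j))
    (c : ℕ → ℕ) where

    -- The product of the `c i` with 1 ≤ i ≤ k and `S i`. Two choices of S matter: the divisors of a
    -- number K give the denominator in the recursion for `c`, and the full set gives D_m.
    sel : {S : Pred ℕ 0ℓ} → Decidable S → ℕ → ℕ
    sel S? zero = 1
    sel S? (suc k) with S? (suc k)
    ... | yes _ = sel S? k * c (suc k)
    ... | no  _ = sel S? k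

    module _ (c-rec : ∀ k → c (suc k) ≡ divℕ (a (suc k)) (sel (_∣? suc k) k)) where

      open IsLcm

      -- With A = a_(k+1), x the lcm so far and e the lcm over the proper divisors of k + 1, the new
      -- factor is A / e, so x · (A / e) is lcm(x, A) as soon as gcd(x, A) = e. That e divides x
      -- uses that S is closed under divisors. The induction quantifies over S because e belongs to
      -- a different S than x.
      sel-isLcm : ∀ k {S : Pred ℕ 0ℓ} (S? : Decidable S) → (∀ {i j} → i ∣ j → S j → S i) →
                  IsLcm a S k (sel S? k)
      sel-isLcm zero S? _ = record
        { nonzero = λ ()
        ; upper   = λ { (s≤s _) () }
        ; least   = λ {z} {E} z∣1 _ → subst (_∣ E) (sym (∣1⇒≡1 z∣1)) (1∣ E)
        }
      sel-isLcm (suc k) {S} S? down with S? (suc k)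
      ... | no ¬s = record
        { nonzero = nonzero ih
        ; upper   = λ 1≤i i≤k s → upper ih 1≤i (below i≤k s) s
        ; least   = λ z∣x h → least ih z∣x (λ 1≤i i≤k → h 1≤i (m≤n⇒m≤1+n i≤k))
        }
        where
        ih : IsLcm a S k (sel S? k)
        ih = sel-isLcm k S? down
        below : ∀ {i} → i ≤ suc k → S i → i ≤ k
        below i≤k s with m≤n⇒m<n∨m≡n i≤k
        ... | inj₁ (s≤s i≤k′) = i≤k′
        ... | inj₂ refl = ⊥-elim (¬s s)
      ... | yes s = record
        { nonzero = nonzero′
        ; upper   = upper′
        ; least   = least′
        }
        where
        A x e a₁ : ℕ
        A = a (suc k)
        x = sel S? k
        e = sel (_∣? suc k) k
        a₁ = c (suc k)
        ih : IsLcm a S k x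
        ih = sel-isLcm k S? down
        ihₑ : IsLcm a (_∣ suc k) k e
        ihₑ = sel-isLcm k (_∣? suc k) ∣-trans
        e∣A : e ∣ A
        e∣A = least ihₑ ∣-refl (λ _ _ i∣k → ∣-trans (gcd[m,n]∣m _ e) (a-mono i∣k))
        e∣x : e ∣ x
        e∣x = least ihₑ ∣-refl (λ 1≤i i≤k i∣k → ∣-trans (gcd[m,n]∣m _ e) (upper ih 1≤i i≤k (down i∣k s)))
        x₁ : ℕ
        x₁ = quotient e∣x
        x≡ : x ≡ x₁ * e
        x≡ = _∣_.equality e∣x
        A≡ : A ≡ a₁ * e
        A≡ = trans (divℕ-exact (nonzero ihₑ) e∣A) (cong (_* e) (sym (c-rec k)))
        -- By `least` it suffices to treat each a_i separately. A common divisor of a_i and A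
        -- divides a_(gcd(i, k+1)), and since i ≤ k this index is a proper divisor of k + 1, hence
        -- one of those collected in e.
        gcd∣e : gcd x A ∣ e
        gcd∣e = least ih (gcd[m,n]∣m x A) λ {i} 1≤i i≤k _ →
          ∣-trans
            (a-gcd i (suc k) (gcd[m,n]∣m (a i) (gcd x A))
              (∣-trans (gcd[m,n]∣n (a i) (gcd x A)) (gcd[m,n]∣n x A)))
            (upper ihₑ (n≢0⇒n>0 (λ eq → gcd[m,n]≢0 i (suc k) (inj₂ λ ()) eq))
              (≤-trans (∣⇒≤ {{>-nonZero 1≤i}} (gcd[m,n]∣m i (suc k))) i≤k) (gcd[m,n]∣n i (suc k)))
        coprime : gcd x₁ a₁ ≡ 1
        coprime = gcd-cofactors x₁ a₁ (nonzero ihₑ) x≡ A≡ gcd∣e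
        x*a₁≡ : x * a₁ ≡ A * x₁
        x*a₁≡ = begin
          x * a₁          ≡⟨ cong (_* a₁) x≡ ⟩
          (x₁ * e) * a₁   ≡⟨ *-assoc x₁ e a₁ ⟩
          x₁ * (e * a₁)   ≡⟨ cong (x₁ *_) (trans (*-comm e a₁) (sym A≡)) ⟩
          x₁ * A          ≡⟨ *-comm x₁ A ⟩
          A * x₁          ∎
          where open ≡-Reasoning
        nonzero′ : x * a₁ ≢ 0
        nonzero′ eq with m*n≡0⇒m≡0∨n≡0 x eq
        ... | inj₁ x≡0 = nonzero ih x≡0
        ... | inj₂ a₁≡0 = a≢0 k (trans A≡ (cong (_* e) a₁≡0))
        upper′ : ∀ {i} → 1 ≤ i → i ≤ suc k → S i → a i ∣ x * a₁
        upper′ 1≤i i≤k si with m≤n⇒m<n∨m≡n i≤k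
        ... | inj₁ (s≤s i≤k′) = ∣m⇒∣m*n a₁ (upper ih 1≤i i≤k′ si)
        ... | inj₂ refl = subst (A ∣_) (sym x*a₁≡) (m∣m*n x₁)
        least′ : ∀ {z E} → z ∣ x * a₁ →
                 (∀ {i} → 1 ≤ i → i ≤ suc k → S i → gcd (a i) z ∣ E) → z ∣ E
        -- Writing the new product as A x₁ or as x a₁ shows that z divides both x₁ E and a₁ E, and
        -- x₁, a₁ are coprime.
        least′ {z} {E} z∣ h = subst (z ∣_) (trans (cong (_* E) coprime) (*-identityˡ E))
                                (∣-gcd-*ʳ x₁ a₁ E z∣x₁E z∣a₁E)
          where
          gcd[A,z]∣E : gcd A z ∣ E
          gcd[A,z]∣E = h (s≤s z≤n) ≤-refl s
          gcd[x,z]∣E : gcd x z ∣ E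
          gcd[x,z]∣E = least ih (gcd[m,n]∣m x z) λ {i} 1≤i i≤k si →
            ∣-trans (gcd-greatest (gcd[m,n]∣m (a i) _) (∣-trans (gcd[m,n]∣n (a i) _) (gcd[m,n]∣n x z)))
                    (h 1≤i (m≤n⇒m≤1+n i≤k) si)
          z∣x₁E : z ∣ x₁ * E
          z∣x₁E = subst (z ∣_) (*-comm E x₁)
            (∣-trans (∣-gcd-*ʳ A z x₁ (subst (z ∣_) x*a₁≡ z∣) (m∣m*n x₁)) (*-monoˡ-∣ x₁ gcd[A,z]∣E))
          z∣a₁E : z ∣ a₁ * E
          z∣a₁E = subst (z ∣_) (*-comm E a₁)
            (∣-trans (∣-gcd-*ʳ x z a₁ z∣ (m∣m*n a₁)) (*-monoˡ-∣ a₁ gcd[x,z]∣E))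

  -- Here and in Parameters, a definition by an underscore gives a name to a where-local
  -- function of Defs: the equation proved right after it forces the solution.
  mutual
    selGo : ℕ → List ℕ → ℕ → List ℕ → ℕ
    selGo = _

    nextVal : ℕ → ℕ → List ℕ → ℕ
    nextVal a K []       = divℕ a 1
    nextVal a K (v ∷ vs) = divℕ a (v * selGo K (v ∷ vs) 2 vs)

    cycloList-nextVal : ∀ n k → 1 ∣ suc k →
      cycloList n (suc k) ≡ cycloList n k ++ (nextVal (n ^ suc k ∸ 1) (suc k) (cycloList n k) ∷ [])
    cycloList-nextVal n k 1∣ with cycloList n k | n ^ suc k ∸ 1
    ... | []     | a = refl
    ... | v ∷ vs | a with 1 ∣? suc k
    ... | no ¬1∣ = ⊥-elim (¬1∣ 1∣)
    -- With the compound arguments abstracted to variables, `selGo` is applied to distinct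
    -- variables, so the equation has a unique solution: the product of the list that the local
    -- recursion selects.
    ... | yes _ with suc k | v ∷ vs | 2
    ... | K | W | t = refl

  Φ : ℕ → ℕ → ℕ
  Φ n zero    = 1
  Φ n (suc k) = divℕ (n ^ suc k ∸ 1) (selGo (suc k) (cycloList n k) 1 (cycloList n k))

  length-cycloList : ∀ n k → length (cycloList n k) ≡ k
  length-cycloList n zero = refl
  length-cycloList n (suc k) = trans (length-++ (cycloList n k))
    (trans (cong (_+ 1) (length-cycloList n k)) (+-comm k 1))

  prodℕ-∷ʳ : ∀ vs v → prodℕ (vs ++ (v ∷ [])) ≡ prodℕ vs * v
  prodℕ-∷ʳ []       v = *-comm v 1
  prodℕ-∷ʳ (x ∷ vs) v = trans (cong (x *_) (prodℕ-∷ʳ vs v)) (sym (*-assoc x _ v))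

  -- The head of the list carries index `d`, so the appended entry carries index `d + length vs`.
  selGo-∷ʳ-∣ : ∀ K W d vs v → d + length vs ∣ K → selGo K W d (vs ++ (v ∷ [])) ≡ selGo K W d vs * v
  selGo-∷ʳ-∣ K W d [] v h with d ∣? K
  ... | yes _ = *-comm v 1
  ... | no ¬p = ⊥-elim (¬p (subst (_∣ K) (+-identityʳ d) h))
  selGo-∷ʳ-∣ K W d (x ∷ vs) v h with d ∣? K
  ... | yes _ = trans (cong (x *_) (selGo-∷ʳ-∣ K W (suc d) vs v (subst (_∣ K) (+-suc d _) h))) (sym (*-assoc x _ v))
  ... | no  _ = selGo-∷ʳ-∣ K W (suc d) vs v (subst (_∣ K) (+-suc d _) h)

  selGo-∷ʳ-∤ : ∀ K W d vs v → ¬ d + length vs ∣ K → selGo K W d (vs ++ (v ∷ [])) ≡ selGo K W d vs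
  selGo-∷ʳ-∤ K W d [] v h with d ∣? K
  ... | yes p = ⊥-elim (h (subst (_∣ K) (sym (+-identityʳ d)) p))
  ... | no  _ = refl
  selGo-∷ʳ-∤ K W d (x ∷ vs) v h with d ∣? K
  ... | yes _ = cong (x *_) (selGo-∷ʳ-∤ K W (suc d) vs v (λ p → h (subst (_∣ K) (sym (+-suc d _)) p)))
  ... | no  _ = selGo-∷ʳ-∤ K W (suc d) vs v (λ p → h (subst (_∣ K) (sym (+-suc d _)) p))

  always? : Decidable {A = ℕ} (λ _ → ⊤)
  always? _ = yes tt

  module Cyclotomic {n : ℕ} (2≤n : 2 ≤ n) where

    1≤n : 1 ≤ n
    1≤n = ≤-trans (s≤s z≤n) 2≤n

    pow∸1≢0 : ∀ k → n ^ suc k ∸ 1 ≢ 0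
    pow∸1≢0 k eq = <⇒≱ 2≤n (≤-trans (m≤m*n n (n ^ k) {{>-nonZero (1≤^ k 1≤n)}}) (m∸n≡0⇒m≤n eq))

    open StrongDivisibility (λ k → n ^ k ∸ 1) pow∸1≢0 (pow∸1-mono 1≤n) (pow∸1-gcd 1≤n) (Φ n)

    selGo≡sel : ∀ K W k → selGo K W 1 (cycloList n k) ≡ sel (_∣? K) k
    selGo≡sel K W zero = refl
    selGo≡sel K W (suc k) with suc k ∣? K
    ... | yes p = trans (selGo-∷ʳ-∣ K W 1 (cycloList n k) (Φ n (suc k))
                    (subst (λ l → suc l ∣ K) (sym (length-cycloList n k)) p))
                    (cong (_* Φ n (suc k)) (selGo≡sel K W k))
    ... | no ¬p = trans (selGo-∷ʳ-∤ K W 1 (cycloList n k) (Φ n (suc k))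
                    (λ p → ¬p (subst (λ l → suc l ∣ K) (length-cycloList n k) p)))
                    (selGo≡sel K W k)

    Dm≡sel : ∀ k → Dm k n ≡ sel always? k
    Dm≡sel zero = refl
    Dm≡sel (suc k) = trans (prodℕ-∷ʳ (cycloList n k) (Φ n (suc k))) (cong (_* Φ n (suc k)) (Dm≡sel k))

    Dm-isLcm : ∀ m → IsLcm (λ k → n ^ k ∸ 1) (λ _ → ⊤) m (Dm m n)
    Dm-isLcm m = subst (IsLcm _ _ m) (sym (Dm≡sel m))
      (sel-isLcm (λ k → cong (divℕ (n ^ suc k ∸ 1)) (selGo≡sel (suc k) (cycloList n k) k)) m always? (λ _ _ → tt))

  DmP≢0 : ∀ m {P} → All Prime P → DmP m P ≢ 0
  DmP≢0 m []         = λ ()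
  DmP≢0 m (pr ∷ prs) = lcm≢0 (IsLcm.nonzero (Cyclotomic.Dm-isLcm (prime⇒2≤ pr) m)) (DmP≢0 m prs)

  Dm∣DmP : ∀ m {P q} → q ∈ P → Dm m q ∣ DmP m P
  Dm∣DmP m {q ∷ P} (here refl) = m∣lcm[m,n] (Dm m q) (DmP m P)
  Dm∣DmP m {q ∷ P} (there q∈P) = ∣-trans (Dm∣DmP m q∈P) (n∣lcm[m,n] (Dm m q) (DmP m P))

-- Stripping to D″, the order of p, and monotonicity of ∇.

module Parameters where

  open import Data.Empty using (⊥-elim)
  open import Data.Fin using (Fin; toℕ; fromℕ<)
  open import Data.Fin.Properties using (pigeonhole; toℕ-fromℕ<; toℕ<n)
  open import Data.List using (List; []; _∷_; foldr; applyUpTo)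
  open import Data.List.Membership.Propositional using (_∈_)
  open import Data.List.Relation.Binary.Sublist.Propositional using (_⊆_; []; _∷_; _∷ʳ_; minimum)
  open import Data.List.Relation.Binary.Sublist.Propositional.Properties using (map⁺; filter⁺)
  open import Data.List.Relation.Unary.All using (All; []; _∷_)
  open import Data.List.Relation.Unary.Any using (here; there)
  open import Data.Nat
  open import Data.Nat.Coprimality using (Coprime)
  open import Data.Nat.Divisibility
  open import Data.Nat.DivMod using (_%_; m%n<n)
  open import Data.Nat.Primality using (Prime; prime?)
  open import Data.Nat.Properties
  open import Data.Product using (∃; ∃₂; _×_; _,_; proj₁; proj₂)
  open import Data.Sum using (inj₁; inj₂)
  open import Function.Base using (id; _∘_)
  open import Relation.Binary.PropositionalEquality
  open import Relation.Nullary using (¬_; yes; no)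
  open import Defs
  open Arithmetic
  open Cyclotomics

  mutual
    stripGo : ℕ → ℕ → ℕ → ℕ → ℕ
    stripGo = _

    stripFactor-∣ : ∀ q k → q ∣ suc k → stripFactor q (suc k) ≡ stripGo q (suc k) k (divℕ (suc k) q)
    stripFactor-∣ q k h with q ∣? suc k
    ... | no ¬h = ⊥-elim (¬h h)
    ... | yes _ with divℕ (suc k) q
    ... | y with suc k
    ... | X = refl

  record Stripped (q x y : ℕ) : Set where
    field
      exponent : ℕ
      split    : x ≡ q ^ exponent * y
      q∤       : ¬ q ∣ y

  -- Each division by q ≥ 2 strictly decreases y, which keeps y below the remaining fuel; the search
  -- therefore stops because q no longer divides.
  stripGo-stripped : ∀ {q} → 2 ≤ q → ∀ X f y → y ≢ 0 → y ≤ f → Stripped q y (stripGo q X f y)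
  stripGo-stripped 2≤q X zero    y y≢0 y≤f = ⊥-elim (y≢0 (n≤0⇒n≡0 y≤f))
  stripGo-stripped {q} 2≤q X (suc f) y y≢0 y≤f with q ∣? y
  ... | no  q∤y = record { exponent = 0 ; split = sym (*-identityˡ y) ; q∤ = q∤y }
  ... | yes q∣y = record
    { exponent = suc (Stripped.exponent ih)
    ; split    = trans y≡ (trans (cong (_* q) (Stripped.split ih)) (trans (*-comm _ q) (sym (*-assoc q _ _))))
    ; q∤       = Stripped.q∤ ih
    }
    where
    y≡ : y ≡ divℕ y q * q
    y≡ = divℕ-exact (λ { refl → <⇒≱ 2≤q z≤n }) q∣y
    q′≢0 : divℕ y q ≢ 0
    q′≢0 eq = y≢0 (trans y≡ (cong (_* q) eq))
    ih : Stripped q (divℕ y q) (stripGo q X f (divℕ y q))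
    ih = stripGo-stripped 2≤q X f (divℕ y q) q′≢0
      (s≤s⁻¹ (≤-trans (subst (divℕ y q <_) (sym y≡)
        (m<m*n (divℕ y q) q {{≢-nonZero q′≢0}} 2≤q)) y≤f))

  stripFactor-stripped : ∀ {q} → 2 ≤ q → ∀ x → x ≢ 0 → Stripped q x (stripFactor q x)
  stripFactor-stripped 2≤q x x≢0 = stripGo-stripped 2≤q x x x x≢0 ≤-refl

  -- All that is kept of the factor D′ is that it divides a power of N. The exponent s is the sum of
  -- the multiplicities removed, each q^e being replaced by N^e.
  stripAll-split : ∀ {N} {P} → All Prime P → (∀ {q} → q ∈ P → q ∣ N) → ∀ x → x ≢ 0 →
    ∃ λ s → x ∣ N ^ s * foldr stripFactor x P
  stripAll-nonzero : ∀ {P} → All Prime P → ∀ x → x ≢ 0 → foldr stripFactor x P ≢ 0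

  stripAll-nonzero [] x x≢0 = x≢0
  stripAll-nonzero {q ∷ P} (pr ∷ prs) x x≢0 eq =
    stripAll-nonzero prs x x≢0 (trans split (trans (cong (q ^ exponent *_) eq) (*-zeroʳ (q ^ exponent))))
    where
    open Stripped (stripFactor-stripped (prime⇒2≤ pr) (foldr stripFactor x P) (stripAll-nonzero prs x x≢0))

  stripAll-split [] h x x≢0 = 0 , n∣m*n 1
  stripAll-split {N} {q ∷ P} (pr ∷ prs) h x x≢0 = s + exponent ,
    ∣-trans x∣ (∣-trans (*-monoʳ-∣ (N ^ s) (subst (_∣ N ^ exponent * r′) (sym split)
      (*-monoˡ-∣ r′ (^-mono-∣ (h (here refl)) exponent))))
      (∣-reflexive (trans (sym (*-assoc (N ^ s) _ r′)) (cong (_* r′) (sym (^-distribˡ-+-* N s exponent))))))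
    where
    r r′ : ℕ
    r = foldr stripFactor x P
    r′ = stripFactor q r
    open Stripped (stripFactor-stripped (prime⇒2≤ pr) r (stripAll-nonzero prs x x≢0))
    rec : ∃ λ s → x ∣ N ^ s * r
    rec = stripAll-split prs (λ q∈ → h (there q∈)) x x≢0
    s : ℕ
    s = proj₁ rec
    x∣ : x ∣ N ^ s * r
    x∣ = proj₂ rec

  -- Every stripping passes to a divisor, so a prime that has been removed cannot return.
  stripAll-∤ : ∀ {P} → All Prime P → ∀ x → x ≢ 0 → ∀ {p} → p ∈ P → ¬ p ∣ foldr stripFactor x P
  stripAll-∤ {q ∷ P} (pr ∷ prs) x x≢0 = λ
    { (here refl) → q∤
    ; (there p∈) p∣ → stripAll-∤ prs x x≢0 p∈ (subst (_ ∣_) (sym split) (∣n⇒∣m*n (q ^ exponent) p∣)) }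
    where
    open Stripped (stripFactor-stripped (prime⇒2≤ pr) (foldr stripFactor x P) (stripAll-nonzero prs x x≢0))

  mutual
    orderGo : ℕ → ℕ → ℕ → ℕ → ℕ
    orderGo = _

    multOrder-∤ : ∀ p d → ¬ (suc d ∣ p ^ 1 ∸ 1) → multOrder p (suc d) ≡ orderGo p (suc d) 2 d
    multOrder-∤ p d h with suc d ∣? (p ^ 1 ∸ 1)
    ... | yes y = ⊥-elim (h y)
    ... | no _ with suc d | 2
    ... | D | t = refl

  -- When its fuel runs out the search returns an untested exponent. A valid exponent j inside the
  -- window [k, k + f) excludes this.
  orderGo-∣ : ∀ p D k f j → k ≤ j → j < k + f → D ∣ p ^ j ∸ 1 → D ∣ p ^ orderGo p D k f ∸ 1
  orderGo-∣ p D k zero    j k≤j j< D∣ = ⊥-elim (<⇒≱ j< (≤-trans (≤-reflexive (+-identityʳ k)) k≤j))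
  orderGo-∣ p D k (suc f) j k≤j j< D∣ with D ∣? (p ^ k ∸ 1)
  ... | yes h = h
  ... | no ¬h with m≤n⇒m<n∨m≡n k≤j
  ... | inj₁ k<j = orderGo-∣ p D (suc k) f j k<j (subst (j <_) (+-suc k f) j<) D∣
  ... | inj₂ refl = ⊥-elim (¬h D∣)

  -- Two of the D + 1 powers p^0, ..., p^D agree modulo D. Cancelling the smaller one gives an
  -- exponent between 1 and D, exactly the range that is searched.
  multOrder-∣ : ∀ {p D} → 1 ≤ p → D ≢ 0 → Coprime D p → D ∣ p ^ multOrder p D ∸ 1
  multOrder-∣ {p} {zero} 1≤p D≢0 c = ⊥-elim (D≢0 refl)
  multOrder-∣ {p} {D@(suc _)} 1≤p D≢0 c = fromPigeonhole (pigeonhole (n<1+n D) f)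
    where
    f : Fin (suc D) → Fin D
    f i = fromℕ< (m%n<n (p ^ toℕ i) D)
    fromPigeonhole : (∃₂ λ i j → toℕ i < toℕ j × f i ≡ f j) → D ∣ p ^ multOrder p D ∸ 1
    fromPigeonhole (i , j , i<j , fi≡fj) = orderGo-∣ p D 1 D e 1≤e e<1+D
        (coprime-^-∣ c (toℕ i) (subst (D ∣_) eq (%-≡⇒∣∸ (p ^ toℕ i) (p ^ toℕ j) D %≡)))
      where
      e : ℕ
      e = toℕ j ∸ toℕ i
      1≤e : 1 ≤ e
      1≤e = m<n⇒0<n∸m i<j
      e<1+D : e < 1 + D
      e<1+D = ≤-<-trans (m∸n≤m (toℕ j) (toℕ i)) (toℕ<n j)
      %≡ : p ^ toℕ i % D ≡ p ^ toℕ j % D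
      %≡ = trans (sym (toℕ-fromℕ< _)) (trans (cong toℕ fi≡fj) (toℕ-fromℕ< _))
      eq : p ^ toℕ j ∸ p ^ toℕ i ≡ p ^ toℕ i * (p ^ e ∸ 1)
      eq = begin
        p ^ toℕ j ∸ p ^ toℕ i                ≡⟨ cong (λ t → p ^ t ∸ p ^ toℕ i) (sym (m+[n∸m]≡n (<⇒≤ i<j))) ⟩
        p ^ (toℕ i + e) ∸ p ^ toℕ i          ≡⟨ cong (_∸ p ^ toℕ i) (^-distribˡ-+-* p (toℕ i) e) ⟩
        p ^ toℕ i * p ^ e ∸ p ^ toℕ i        ≡⟨ cong (p ^ toℕ i * p ^ e ∸_) (sym (*-identityʳ (p ^ toℕ i))) ⟩
        p ^ toℕ i * p ^ e ∸ p ^ toℕ i * 1    ≡⟨ sym (*-distribˡ-∸ (p ^ toℕ i) (p ^ e) 1) ⟩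
        p ^ toℕ i * (p ^ e ∸ 1)              ∎
        where open ≡-Reasoning

  applyUpTo-⊆ : ∀ {a} {A : Set a} (f : ℕ → A) {k l} → k ≤ l → applyUpTo f k ⊆ applyUpTo f l
  applyUpTo-⊆ f z≤n       = minimum _
  applyUpTo-⊆ f (s≤s k≤l) = refl ∷ applyUpTo-⊆ (f ∘ suc) k≤l

  prodℕ-⊆ : ∀ {as bs} → as ⊆ bs → prodℕ as ∣ prodℕ bs
  prodℕ-⊆ []           = ∣-refl
  prodℕ-⊆ (b ∷ʳ as⊆bs) = ∣n⇒∣m*n b (prodℕ-⊆ as⊆bs)
  prodℕ-⊆ {a ∷ _} (refl ∷ as⊆bs) = *-monoʳ-∣ a (prodℕ-⊆ as⊆bs)

  -- The factor belonging to q depends only on m and q, so it suffices that the prime divisors of k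
  -- form a sublist of those of l.
  nabla-∣ : ∀ m {k l} → .{{NonZero l}} → k ∣ l → nabla m k ∣ nabla m l
  nabla-∣ m {k} {l} k∣l = prodℕ-⊆ (map⁺ _ (filter⁺ (_∣? k) (_∣? l) (λ { refl q∣k → ∣-trans q∣k k∣l })
    (filter⁺ prime? prime? (λ { refl pr → pr }) (map⁺ suc (applyUpTo-⊆ id (∣⇒≤ k∣l))))))

-- Roots of polynomials over commutative rings of prime characteristic.

module PolynomialRoots where

  open import Algebra.Bundles using (CommutativeRing)
  open import Data.Empty using (⊥-elim)
  open import Data.Fin as Fin using (Fin; toℕ; inject₁; fromℕ)
  open import Data.Fin.Properties using (toℕ<n; toℕ-fromℕ; toℕ-inject₁)
  open import Data.Nat as ℕ using (ℕ; zero; suc; _≤_; _<_; s≤s; z≤n; _∸_)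
  open import Data.Nat.Combinatorics using (_C_; nCn≡1)
  open import Data.Nat.Coprimality using (coprime-Bézout; prime⇒coprime)
  open import Data.Nat.Divisibility as ℕD using (_∣_; divides)
  open import Data.Nat.GCD using (module Bézout)
  open import Data.Nat.Primality using (Prime)
  import Data.Nat.Properties as ℕₚ
  open import Data.Product using (∃; _,_) renaming (_×_ to _∧_)
  open import Data.Sum using (_⊎_; inj₁; inj₂)
  open import Data.Vec using (Vec; []; _∷_; tabulate)
  open import Data.Vec.Relation.Unary.All using (All; []; _∷_)
  open import Data.Vec.Relation.Unary.Any using (Any; here; there)
  open import Relation.Binary.Definitions using (tri<; tri≈; tri>)
  open import Relation.Binary.PropositionalEquality as ≡ using (_≡_; _≢_)
  open Arithmetic

  module PrimeCharacteristic
    {c ℓ} (R : CommutativeRing c ℓ) {q : ℕ} (q-prime : Prime q) where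

    open CommutativeRing R
    open import Algebra.Properties.Semiring.Exp semiring using (_^_; ^-homo-*; ^-assocʳ; ^-congˡ; ^-congʳ)
    open import Algebra.Properties.CommutativeSemiring.Exp commutativeSemiring using (^-distrib-*)
    open import Algebra.Properties.Semiring.Mult semiring
      using (_×_; ×-congʳ; ×-congˡ; ×-homo-+; ×-assocˡ; ×-comm-*; ×-assoc-*)
    open import Algebra.Properties.Semiring.Sum semiring
      using (sum; sum-cong-≋; sum-replicate-zero; sum-init-last)
    open import Algebra.Properties.CommutativeSemiring.Binomial commutativeSemiring
      using (binomialTerm) renaming (theorem to binomial-theorem)
    open import Algebra.Properties.Ring ring
    open import Algebra.Properties.CommutativeSemigroup *-commutativeSemigroup
      using (x∙yz≈y∙xz; xy∙z≈xz∙y; xy∙z≈y∙xz)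
    open import Relation.Binary.Reasoning.Setoid setoid

    evalPoly : ∀ {n} → Vec Carrier n → Carrier → Carrier
    evalPoly []                 x = 0#
    evalPoly {suc n} (a ∷ as) x = a * x ^ n + evalPoly as x

    evalPoly-cong : ∀ {n} (as : Vec Carrier n) {x y} → x ≈ y → evalPoly as x ≈ evalPoly as y
    evalPoly-cong [] _ = refl
    evalPoly-cong {suc n} (a ∷ as) x≈y = +-cong (*-congˡ (^-congˡ n x≈y)) (evalPoly-cong as x≈y)

    evalPoly-- : ∀ {n} (f g : Fin n → Carrier) x →
      evalPoly (tabulate (λ i → f i - g i)) x ≈ evalPoly (tabulate f) x - evalPoly (tabulate g) x
    evalPoly-- {zero} f g x = sym (-‿inverseʳ 0#)
    evalPoly-- {suc n} f g x = begin
      (f Fin.zero - g Fin.zero) * x ^ n + evalPoly (tabulate (λ i → f (Fin.suc i) - g (Fin.suc i))) x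
        ≈⟨ +-cong (trans (distribʳ _ _ _) (+-congˡ (sym (-‿distribˡ-* _ _)))) (evalPoly-- (λ i → f (Fin.suc i)) (λ i → g (Fin.suc i)) x) ⟩
      (f₀ - g₀) + (f₁ - g₁)     ≈⟨ interchange f₀ (- g₀) f₁ (- g₁) ⟩
      (f₀ + f₁) + (- g₀ - g₁)   ≈⟨ +-congˡ (-‿+-comm g₀ g₁) ⟩
      (f₀ + f₁) - (g₀ + g₁)     ∎
      where
      open import Algebra.Properties.CommutativeSemigroup +-commutativeSemigroup using (interchange)
      f₀ g₀ f₁ g₁ : Carrier
      f₀ = f Fin.zero * x ^ n
      g₀ = g Fin.zero * x ^ n
      f₁ = evalPoly (tabulate (λ i → f (Fin.suc i))) x
      g₁ = evalPoly (tabulate (λ i → g (Fin.suc i))) x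

    -- Synthetic division of `a ∷ as` by X - z: the entries are the successive Horner values at z,
    -- without the last one, which is the remainder. The leading coefficient `a` survives unchanged,
    -- so it can be followed through repeated divisions.
    quot : ∀ {n} → Carrier → Vec Carrier n → Carrier → Vec Carrier n
    quot z []       a = []
    quot z (b ∷ as) a = a ∷ quot z as (b + z * a)

    -- f(X) − f(z) = (X − z) g(X), with both sides moved so that no subtraction occurs.
    evalPoly-quot : ∀ {n} z (as : Vec Carrier n) a x →
      evalPoly (a ∷ as) x + z * evalPoly (quot z as a) x ≈ x * evalPoly (quot z as a) x + evalPoly (a ∷ as) z
    evalPoly-quot z [] a x = begin
      (a * 1# + 0#) + z * 0#   ≈⟨ +-cong refl (zeroʳ z) ⟩
      (a * 1# + 0#) + 0#       ≈⟨ +-comm _ _ ⟩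
      0# + (a * 1# + 0#)       ≈⟨ +-congʳ (zeroʳ x) ⟨
      x * 0# + (a * 1# + 0#)   ∎
    evalPoly-quot {suc n} z (b ∷ as) a x = begin
      (a * (x * X) + (b * X + F)) + z * (a * X + G)        ≈⟨ solve₁ ⟩
      x * (a * X) + (((b + z * a) * X + F) + z * G)        ≈⟨ +-congˡ (evalPoly-quot z as (b + z * a) x) ⟩
      x * (a * X) + (x * G + ((b + z * a) * Z + F′))       ≈⟨ solve₂ ⟩
      x * (a * X + G) + (a * (z * Z) + (b * Z + F′))       ∎
      where
      X Z F F′ G : Carrier
      X = x ^ n
      Z = z ^ n
      F = evalPoly as x
      F′ = evalPoly as z
      G = evalPoly (quot z as (b + z * a)) x
      open import Algebra.Solver.Ring.NaturalCoefficients.Default commutativeSemiring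
      solve₁ : (a * (x * X) + (b * X + F)) + z * (a * X + G) ≈ x * (a * X) + (((b + z * a) * X + F) + z * G)
      solve₁ = solve 7 (λ a x X b F z G → (a :* (x :* X) :+ (b :* X :+ F)) :+ z :* (a :* X :+ G) :=
                         x :* (a :* X) :+ (((b :+ z :* a) :* X :+ F) :+ z :* G)) refl a x X b F z G
      solve₂ : x * (a * X) + (x * G + ((b + z * a) * Z + F′)) ≈ x * (a * X + G) + (a * (z * Z) + (b * Z + F′))
      solve₂ = solve 8 (λ a x X b F z G Z → x :* (a :* X) :+ (x :* G :+ ((b :+ z :* a) :* Z :+ F)) :=
                         x :* (a :* X :+ G) :+ (a :* (z :* Z) :+ (b :* Z :+ F))) refl a x X b F′ z G Z

    -- Divided differences: peeling off the root pts s lowers the degree and costs one factor u.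
    vandermonde : ∀ {m} (pts : ℕ → Carrier) (u : Carrier) →
      (∀ {i j} → i < j → j ≤ m → ∀ r → pts i * r ≈ pts j * r → u * r ≈ 0#) →
      ∀ {d} (as : Vec Carrier d) a c s → s ℕ.+ d ≤ m →
      (∀ i → s ≤ i → i ≤ m → c * evalPoly (a ∷ as) (pts i) ≈ 0#) →
      a * (u ^ d * c) ≈ 0#
    vandermonde pts u sep [] a c s s≤m h = begin
      a * (1# * c)         ≈⟨ *-congˡ (*-identityˡ c) ⟩
      a * c                ≈⟨ *-comm a c ⟩
      c * a                ≈⟨ *-congˡ (trans (+-identityʳ _) (*-identityʳ a)) ⟨
      c * (a * 1# + 0#)    ≈⟨ h s ℕₚ.≤-refl (≡.subst (_≤ _) (ℕₚ.+-identityʳ s) s≤m) ⟩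
      0#                   ∎
    vandermonde {m} pts u sep {suc d} (b ∷ as) a c s s≤m h = begin
      a * ((u * u ^ d) * c)   ≈⟨ *-congˡ (xy∙z≈y∙xz u (u ^ d) c) ⟩
      a * (u ^ d * (u * c))   ≈⟨ vandermonde pts u sep (quot z as (b + z * a)) a (u * c) (suc s)
                                   (≡.subst (_≤ m) (ℕₚ.+-suc s d) s≤m) h′ ⟩
      0#                      ∎
      where
      z : Carrier
      z = pts s
      h′ : ∀ i → suc s ≤ i → i ≤ m → (u * c) * evalPoly (a ∷ quot z as (b + z * a)) (pts i) ≈ 0#
      -- Since c f vanishes at both points, the division identity becomes pts s · c g = pts i · c g,
      -- and `sep` lets u kill c g. The new multiplier is therefore u c.
      h′ i s<i i≤m = trans (*-assoc u c G) (sep s<i i≤m (c * G) (begin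
        z * (c * G)                  ≈⟨ x∙yz≈y∙xz z c G ⟩
        c * (z * G)                  ≈⟨ +-identityˡ _ ⟨
        0# + c * (z * G)             ≈⟨ +-congʳ (h i (ℕₚ.<⇒≤ s<i) i≤m) ⟨
        c * F x + c * (z * G)        ≈⟨ distribˡ c _ _ ⟨
        c * (F x + z * G)            ≈⟨ *-congˡ (evalPoly-quot z (b ∷ as) a x) ⟩
        c * (x * G + F z)            ≈⟨ distribˡ c _ _ ⟩
        c * (x * G) + c * F z        ≈⟨ +-congˡ (h s ℕₚ.≤-refl (ℕₚ.≤-trans (ℕₚ.m≤m+n s (suc d)) s≤m)) ⟩
        c * (x * G) + 0#             ≈⟨ +-identityʳ _ ⟩
        c * (x * G)                  ≈⟨ x∙yz≈y∙xz c x G ⟩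
        x * (c * G)                  ∎))
        where
        x G : Carrier
        x = pts i
        G = evalPoly (quot z (b ∷ as) a) x
        F : Carrier → Carrier
        F = evalPoly (a ∷ b ∷ as)

    Regular : Carrier → Set _
    Regular a = ∀ r → a * r ≈ 0# → r ≈ 0#

    -- Zero leading coefficients are skipped until a regular one appears, which can then be
    -- cancelled from a · u^d = 0. Hence d is the degree that remains, at most m.
    vandermonde-regular : ∀ {m} (pts : ℕ → Carrier) (u : Carrier) →
      (∀ {i j} → i < j → j ≤ m → ∀ r → pts i * r ≈ pts j * r → u * r ≈ 0#) →
      ∀ {n} {as : Vec Carrier n} → n ≤ suc m → All (λ a → a ≈ 0# ⊎ Regular a) as → Any Regular as →
      (∀ i → i ≤ m → evalPoly as (pts i) ≈ 0#) →
      ∃ λ d → (d ≤ m) ∧ (u ^ d ≈ 0#)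
    vandermonde-regular {m} pts u sep {suc d} {a ∷ as} (s≤s d≤m) (inj₂ reg ∷ _) _ h =
      d , d≤m , trans (sym (*-identityʳ _)) (reg _ (vandermonde pts u sep as a 1# 0 d≤m
        (λ i _ i≤m → trans (*-identityˡ _) (h i i≤m))))
    vandermonde-regular pts u sep n≤ (inj₁ a≈0 ∷ oks) (there reg) h =
      vandermonde-regular pts u sep (ℕₚ.≤-trans (ℕₚ.n≤1+n _) n≤) oks reg
        (λ i i≤m → trans (sym (trans (+-congʳ (trans (*-congʳ a≈0) (zeroˡ _))) (+-identityˡ _))) (h i i≤m))
    -- A coefficient that is both zero and regular forces 1 = 0, so already u^0 vanishes.
    vandermonde-regular pts u sep {suc d} {a ∷ as} (s≤s d≤m) (inj₁ a≈0 ∷ _) (here reg) h =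
      0 , z≤n , reg 1# (trans (*-identityʳ a) a≈0)

    1^ : ∀ n → 1# ^ n ≈ 1#
    1^ zero    = refl
    1^ (suc n) = trans (*-identityˡ _) (1^ n)

    n×0 : ∀ n → n × 0# ≈ 0#
    n×0 zero    = refl
    n×0 (suc n) = trans (+-identityˡ _) (n×0 n)

    module _ (q×1 : q × 1# ≈ 0#) where

      ∣⇒×≈0 : ∀ {k} → q ∣ k → ∀ r → k × r ≈ 0#
      ∣⇒×≈0 (divides t ≡.refl) r = begin
        (t ℕ.* q) × r         ≈⟨ ×-assocˡ r t q ⟨
        t × (q × r)           ≈⟨ ×-congʳ t (×-congʳ q (*-identityˡ r)) ⟨
        t × (q × (1# * r))    ≈⟨ ×-congʳ t (×-assoc-* q 1# r) ⟨
        t × ((q × 1#) * r)    ≈⟨ ×-congʳ t (trans (*-congʳ q×1) (zeroˡ r)) ⟩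
        t × 0#                ≈⟨ n×0 t ⟩
        0#                    ∎

      frobenius-+ : ∀ x y → (x + y) ^ q ≈ x ^ q + y ^ q
      frobenius-+ x y = step q ≡.refl
        where
        -- The copy k of q can be matched as a successor, which exposes the first and the last term
        -- of the binomial sum; all terms between them are multiples of q.
        step : ∀ k → k ≡ q → (x + y) ^ k ≈ x ^ k + y ^ k
        step zero    0≡q = ⊥-elim (ℕₚ.<⇒≱ (prime⇒2≤ q-prime) (ℕₚ.≤-trans (ℕₚ.≤-reflexive (≡.sym 0≡q)) z≤n))
        step (suc k) k≡q = begin
          (x + y) ^ suc k                                   ≈⟨ binomial-theorem (suc k) x y ⟩
          t Fin.zero + sum (λ i → t (Fin.suc i))            ≈⟨ +-cong first rest ⟩
          y ^ suc k + x ^ suc k                             ≈⟨ +-comm _ _ ⟩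
          x ^ suc k + y ^ suc k                             ∎
          where
          t : Fin (suc (suc k)) → Carrier
          t = binomialTerm x y (suc k)
          first : t Fin.zero ≈ y ^ suc k
          first = trans (+-identityʳ _) (*-identityˡ _)
          middle : ∀ i → t (Fin.suc (inject₁ i)) ≈ 0#
          middle i = ∣⇒×≈0 (≡.subst (λ a → q ∣ a C toℕ (Fin.suc (inject₁ i))) (≡.sym k≡q) (prime∣C q-prime (s≤s z≤n)
            (≡.subst₂ _<_ (≡.cong suc (≡.sym (toℕ-inject₁ i))) k≡q (s≤s (toℕ<n i))))) _
          top : t (Fin.suc (fromℕ k)) ≈ x ^ suc k
          top = begin
            (suc k C suc (toℕ (fromℕ k))) × (x ^ suc (toℕ (fromℕ k)) * y ^ (k ∸ toℕ (fromℕ k)))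
              ≡⟨ ≡.cong (λ a → (suc k C suc a) × (x ^ suc a * y ^ (k ∸ a))) (toℕ-fromℕ k) ⟩
            (suc k C suc k) × (x ^ suc k * y ^ (k ∸ k))
              ≡⟨ ≡.cong₂ (λ a b → a × (x ^ suc k * y ^ b)) (nCn≡1 (suc k)) (ℕₚ.n∸n≡0 k) ⟩
            1 × (x ^ suc k * 1#)
              ≈⟨ +-identityʳ _ ⟩
            x ^ suc k * 1#
              ≈⟨ *-identityʳ _ ⟩
            x ^ suc k ∎
          rest : sum (λ i → t (Fin.suc i)) ≈ x ^ suc k
          rest = begin
            sum (λ i → t (Fin.suc i))
              ≈⟨ sum-init-last (λ i → t (Fin.suc i)) ⟩
            sum (λ i → t (Fin.suc (inject₁ i))) + t (Fin.suc (fromℕ k))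
              ≈⟨ +-cong (trans (sum-cong-≋ middle) (sum-replicate-zero k)) top ⟩
            0# + x ^ suc k
              ≈⟨ +-identityˡ _ ⟩
            x ^ suc k ∎

      frobenius^-+ : ∀ s x y → (x + y) ^ (q ℕ.^ s) ≈ x ^ (q ℕ.^ s) + y ^ (q ℕ.^ s)
      frobenius^-+ zero x y = trans (*-identityʳ _) (sym (+-cong (*-identityʳ _) (*-identityʳ _)))
      frobenius^-+ (suc s) x y = begin
        (x + y) ^ (q ℕ.* q ℕ.^ s)                      ≈⟨ ^-assocʳ (x + y) q (q ℕ.^ s) ⟨
        ((x + y) ^ q) ^ (q ℕ.^ s)                      ≈⟨ ^-congˡ (q ℕ.^ s) (frobenius-+ x y) ⟩
        (x ^ q + y ^ q) ^ (q ℕ.^ s)                    ≈⟨ frobenius^-+ s (x ^ q) (y ^ q) ⟩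
        (x ^ q) ^ (q ℕ.^ s) + (y ^ q) ^ (q ℕ.^ s)      ≈⟨ +-cong (^-assocʳ x q _) (^-assocʳ y q _) ⟩
        x ^ (q ℕ.* q ℕ.^ s) + y ^ (q ℕ.* q ℕ.^ s)      ∎

      0^q : 0# ^ q ≈ 0#
      0^q = trans (^-congʳ 0# (≡.sym (ℕₚ.m+[n∸m]≡n (ℕₚ.<⇒≤ (prime⇒2≤ q-prime))))) (zeroˡ _)

      frobenius-neg : ∀ x → (- x) ^ q ≈ - (x ^ q)
      frobenius-neg x = +-inverseʳ-unique (x ^ q) ((- x) ^ q)
        (trans (sym (frobenius-+ x (- x))) (trans (^-congˡ q (-‿inverseʳ x)) 0^q))

      -- Fermat's little theorem for the image of the prime field, obtained from additivity of
      -- Frobenius.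
      ×1-fixed : ∀ k → (k × 1#) ^ q ≈ k × 1#
      ×1-fixed zero    = 0^q
      ×1-fixed (suc k) = trans (frobenius-+ 1# (k × 1#)) (+-cong (1^ q) (×1-fixed k))

      evalPoly-frobenius : ∀ {n} {as : Vec Carrier n} → All (λ a → a ^ q ≈ a) as →
        ∀ x → evalPoly as (x ^ q) ≈ evalPoly as x ^ q
      evalPoly-frobenius [] x = sym 0^q
      evalPoly-frobenius {suc n} {a ∷ as} (fa ∷ fas) x = begin
        a * (x ^ q) ^ n + evalPoly as (x ^ q)       ≈⟨ +-cong (*-cong (sym fa) comm) (evalPoly-frobenius fas x) ⟩
        a ^ q * (x ^ n) ^ q + evalPoly as x ^ q     ≈⟨ +-congʳ (^-distrib-* a (x ^ n) q) ⟨
        (a * x ^ n) ^ q + evalPoly as x ^ q         ≈⟨ frobenius-+ _ _ ⟨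
        (a * x ^ n + evalPoly as x) ^ q             ∎
        where
        comm : (x ^ q) ^ n ≈ (x ^ n) ^ q
        comm = trans (^-assocʳ x q n) (trans (^-congʳ x (ℕₚ.*-comm q n)) (sym (^-assocʳ x n q)))

      root-frobenius : ∀ {n} {as : Vec Carrier n} → All (λ a → a ^ q ≈ a) as →
        ∀ x → evalPoly as x ≈ 0# → ∀ i → evalPoly as (x ^ (q ℕ.^ i)) ≈ 0#
      root-frobenius {as = as} fas x root zero = trans (evalPoly-cong as (*-identityʳ x)) root
      root-frobenius {as = as} fas x root (suc i) = begin
        evalPoly as (x ^ (q ℕ.* q ℕ.^ i))    ≈⟨ evalPoly-cong as (^-assocʳ x q _) ⟨
        evalPoly as ((x ^ q) ^ (q ℕ.^ i))    ≈⟨ root-frobenius fas (x ^ q) (trans (evalPoly-frobenius fas x) (trans (^-congˡ q root) 0^q)) i ⟩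
        0#                                   ∎

      -- Bézout for the coprime pair q, k expresses r through multiples of q × r and k × r, and both
      -- vanish.
      ×1-regular : ∀ k → 0 < k → k < q → Regular (k × 1#)
      ×1-regular k 0<k k<q r kr≈0 = byBézout (coprime-Bézout (prime⇒coprime q-prime {{ℕ.>-nonZero 0<k}} k<q))
        where
        k×r≈0 : k × r ≈ 0#
        k×r≈0 = trans (×-congʳ k (sym (*-identityˡ r))) (trans (sym (×-assoc-* k 1# r)) kr≈0)
        byBézout : Bézout.Identity 1 q k → r ≈ 0#
        byBézout (Bézout.-+ x y eq) = begin
          r                                 ≈⟨ +-identityʳ r ⟨
          r + 0#                            ≈⟨ +-congˡ (∣⇒×≈0 (ℕD.n∣m*n x) r) ⟨
          (1 ℕ.+ x ℕ.* q) × r               ≡⟨ ≡.cong (_× r) eq ⟩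
          (y ℕ.* k) × r                     ≈⟨ ×-assocˡ r y k ⟨
          y × (k × r)                       ≈⟨ ×-congʳ y k×r≈0 ⟩
          y × 0#                            ≈⟨ n×0 y ⟩
          0#                                ∎
        byBézout (Bézout.+- x y eq) = begin
          r                                 ≈⟨ +-identityʳ r ⟨
          r + 0#                            ≈⟨ +-congˡ (trans (sym (×-assocˡ r y k)) (trans (×-congʳ y k×r≈0) (n×0 y))) ⟨
          (1 ℕ.+ y ℕ.* k) × r               ≡⟨ ≡.cong (_× r) eq ⟩
          (x ℕ.* q) × r                     ≈⟨ ∣⇒×≈0 (ℕD.n∣m*n x) r ⟩
          0#                                ∎

      ×1-∸ : ∀ {k l} → l ≤ k → k × 1# - l × 1# ≈ (k ∸ l) × 1#
      ×1-∸ {k} {l} l≤k = begin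
        k × 1# - l × 1#                          ≡⟨ ≡.cong (λ t → t × 1# - l × 1#) (≡.sym (ℕₚ.m∸n+n≡m l≤k)) ⟩
        (k ∸ l ℕ.+ l) × 1# - l × 1#              ≈⟨ +-congʳ (×-homo-+ 1# (k ∸ l) l) ⟩
        ((k ∸ l) × 1# + l × 1#) - l × 1#         ≈⟨ +-assoc _ _ _ ⟩
        (k ∸ l) × 1# + (l × 1# - l × 1#)         ≈⟨ trans (+-congˡ (-‿inverseʳ _)) (+-identityʳ _) ⟩
        (k ∸ l) × 1#                             ∎

      -- Up to sign the difference is t × 1 with 0 ≤ t < q. The first component serves every
      -- coefficient of a difference of two polynomials, the second a position where the two
      -- actually differ.
      ×1-difference : ∀ k l → k < q → l < q →
        (k × 1# - l × 1# ≈ 0# ⊎ Regular (k × 1# - l × 1#)) ∧ (k ≢ l → Regular (k × 1# - l × 1#))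
      ×1-difference k l k<q l<q with ℕₚ.<-cmp k l
      ... | tri≈ _ ≡.refl _ = inj₁ (-‿inverseʳ _) , λ k≢k → ⊥-elim (k≢k ≡.refl)
      ... | tri> _ _ l<k = inj₂ reg , λ _ → reg
        where
        reg : Regular (k × 1# - l × 1#)
        reg r h = ×1-regular (k ∸ l) (ℕₚ.m<n⇒0<n∸m l<k) (ℕₚ.≤-<-trans (ℕₚ.m∸n≤m k l) k<q) r
                    (trans (*-congʳ (sym (×1-∸ (ℕₚ.<⇒≤ l<k)))) h)
      ... | tri< k<l _ _ = inj₂ reg , λ _ → reg
        where
        reg : Regular (k × 1# - l × 1#)
        reg r h = ×1-regular (l ∸ k) (ℕₚ.m<n⇒0<n∸m k<l) (ℕₚ.≤-<-trans (ℕₚ.m∸n≤m l k) l<q) r (begin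
          ((l ∸ k) × 1#) * r               ≈⟨ *-congʳ (×1-∸ (ℕₚ.<⇒≤ k<l)) ⟨
          (l × 1# - k × 1#) * r            ≈⟨ *-congʳ (⁻¹-anti-homo‿- (k × 1#) (l × 1#)) ⟨
          - (k × 1# - l × 1#) * r          ≈⟨ -‿distribˡ-* _ r ⟨
          - ((k × 1# - l × 1#) * r)        ≈⟨ trans (-‿cong h) -0#≈0# ⟩
          0#                               ∎)

      difference-fixed : ∀ {x y} → x ^ q ≈ x → y ^ q ≈ y → (x - y) ^ q ≈ x - y
      difference-fixed fx fy = trans (frobenius-+ _ _) (+-cong fx (trans (frobenius-neg _) (-‿cong fy)))

      -- If r x^(q^i) = r x^(q^j) with i < j ≤ m, then x^(q^j − q^i) fixes r, and
      -- q^j − q^i = q^i (q^(j−i) − 1) divides L q^m.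
      module _ {m L : ℕ} (L-mult : ∀ i → 1 ≤ i → i ≤ m → q ℕ.^ i ∸ 1 ∣ L)
               (x : Carrier) (x-regular : Regular x) where

        private
          y : Carrier
          y = x ^ (L ℕ.* q ℕ.^ m)
          pts : ℕ → Carrier
          pts i = x ^ (q ℕ.^ i)

        ^-regular : ∀ k → Regular (x ^ k)
        ^-regular zero    r h = trans (sym (*-identityˡ r)) h
        ^-regular (suc k) r h = ^-regular k r (x-regular _ (trans (sym (*-assoc x (x ^ k) r)) h))

        ^-cancelˡ : ∀ k {r s} → x ^ k * r ≈ x ^ k * s → r ≈ s
        ^-cancelˡ k {r} {s} h = x∙y⁻¹≈ε⇒x≈y r s (^-regular k (r - s) (trans (x[y-z]≈xy-xz (x ^ k) r s) (x≈y⇒x∙y⁻¹≈ε h)))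

        fixes-^ : ∀ e r → r ≈ x ^ e * r → ∀ t → r ≈ x ^ (t ℕ.* e) * r
        fixes-^ e r h zero    = sym (*-identityˡ r)
        fixes-^ e r h (suc t) = begin
          r                                 ≈⟨ h ⟩
          x ^ e * r                         ≈⟨ *-congˡ (fixes-^ e r h t) ⟩
          x ^ e * (x ^ (t ℕ.* e) * r)       ≈⟨ *-assoc _ _ _ ⟨
          (x ^ e * x ^ (t ℕ.* e)) * r       ≈⟨ *-congʳ (^-homo-* x e (t ℕ.* e)) ⟨
          x ^ (e ℕ.+ t ℕ.* e) * r           ∎

        separated : ∀ {i j} → i < j → j ≤ m → ∀ r → pts i * r ≈ pts j * r → (y - 1#) * r ≈ 0#
        separated {i} {j} i<j j≤m r h = begin
          (y - 1#) * r          ≈⟨ [y-z]x≈yx-zx r y 1# ⟩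
          y * r - 1# * r        ≈⟨ x≈y⇒x∙y⁻¹≈ε (trans (sym r≈yr) (sym (*-identityˡ r))) ⟩
          0#                    ∎
          where
          e : ℕ
          e = q ℕ.^ i ℕ.* (q ℕ.^ (j ∸ i) ∸ 1)
          1≤q : 1 ≤ q
          1≤q = ℕₚ.<⇒≤ (prime⇒2≤ q-prime)
          q^j≡ : q ℕ.^ j ≡ q ℕ.^ i ℕ.+ e
          q^j≡ = ≡.trans (≡.cong (q ℕ.^_) (≡.sym (ℕₚ.m+[n∸m]≡n (ℕₚ.<⇒≤ i<j))))
            (≡.trans (ℕₚ.^-distribˡ-+-* q i (j ∸ i))
              (≡.trans (≡.cong (q ℕ.^ i ℕ.*_) (≡.sym (ℕₚ.m+[n∸m]≡n (1≤^ (j ∸ i) 1≤q))))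
                (≡.trans (ℕₚ.*-distribˡ-+ (q ℕ.^ i) 1 _) (≡.cong (ℕ._+ e) (ℕₚ.*-identityʳ _)))))
          r≈x^er : r ≈ x ^ e * r
          r≈x^er = ^-cancelˡ (q ℕ.^ i) (begin
            x ^ (q ℕ.^ i) * r                   ≈⟨ h ⟩
            x ^ (q ℕ.^ j) * r                   ≈⟨ *-congʳ (trans (^-congʳ x q^j≡) (^-homo-* x (q ℕ.^ i) e)) ⟩
            (x ^ (q ℕ.^ i) * x ^ e) * r         ≈⟨ *-assoc _ _ _ ⟩
            x ^ (q ℕ.^ i) * (x ^ e * r)         ∎)
          e∣ : e ∣ L ℕ.* q ℕ.^ m
          e∣ = ≡.subst (e ∣_) (ℕₚ.*-comm (q ℕ.^ m) L)
            (ℕD.*-pres-∣ (≤⇒^∣^ q i≤m) (L-mult (j ∸ i) (ℕₚ.m<n⇒0<n∸m i<j) (ℕₚ.≤-trans (ℕₚ.m∸n≤m j i) j≤m)))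
            where
            i≤m : i ≤ m
            i≤m = ℕₚ.≤-trans (ℕₚ.<⇒≤ i<j) j≤m
          r≈yr : r ≈ y * r
          r≈yr = trans (fixes-^ e r r≈x^er (ℕD.quotient e∣)) (*-congʳ (^-congʳ x (≡.sym (ℕD._∣_.equality e∣))))

        -- At most m + 1 coefficients mean degree at most m, matched by the m + 1 roots x^(q^i) with
        -- i ≤ m. One factor q^m of the exponent comes from separating these roots. The other comes
        -- from (y - 1)^d = 0 with d ≤ m ≤ q^m, since then y^(q^m) - 1 = (y - 1)^(q^m) = 0.
        root⇒unipotent : ∀ {n} {as : Vec Carrier n} → n ≤ suc m → All (λ a → a ^ q ≈ a) as →
          All (λ a → a ≈ 0# ⊎ Regular a) as → Any Regular as → evalPoly as x ≈ 0# →
          x ^ (L ℕ.* q ℕ.^ m ℕ.* q ℕ.^ m) ≈ 1#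
        root⇒unipotent n≤ fixed oks reg root with vandermonde-regular pts (y - 1#) separated n≤ oks reg
                                                    (λ i _ → root-frobenius fixed x root i)
        ... | d , d≤m , u^d≈0 = begin
          x ^ (L ℕ.* q ℕ.^ m ℕ.* q ℕ.^ m)                 ≈⟨ ^-assocʳ x (L ℕ.* q ℕ.^ m) (q ℕ.^ m) ⟨
          y ^ (q ℕ.^ m)                                   ≈⟨ ^-congˡ (q ℕ.^ m) y≈u+1 ⟩
          ((y - 1#) + 1#) ^ (q ℕ.^ m)                     ≈⟨ frobenius^-+ m (y - 1#) 1# ⟩
          (y - 1#) ^ (q ℕ.^ m) + 1# ^ (q ℕ.^ m)           ≈⟨ +-cong u^q^m≈0 (1^ (q ℕ.^ m)) ⟩
          0# + 1#                                         ≈⟨ +-identityˡ 1# ⟩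
          1#                                              ∎
          where
          y≈u+1 : y ≈ (y - 1#) + 1#
          y≈u+1 = sym (trans (+-assoc y (- 1#) 1#) (trans (+-congˡ (-‿inverseˡ 1#)) (+-identityʳ y)))
          d≤q^m : d ≤ q ℕ.^ m
          d≤q^m = ℕₚ.≤-trans d≤m (n≤q^n (prime⇒2≤ q-prime) m)
          u^q^m≈0 : (y - 1#) ^ (q ℕ.^ m) ≈ 0#
          u^q^m≈0 = begin
            (y - 1#) ^ (q ℕ.^ m)                                ≡⟨ ≡.cong ((y - 1#) ^_) (≡.sym (ℕₚ.m+[n∸m]≡n d≤q^m)) ⟩
            (y - 1#) ^ (d ℕ.+ (q ℕ.^ m ∸ d))                    ≈⟨ ^-homo-* (y - 1#) d _ ⟩
            (y - 1#) ^ d * (y - 1#) ^ (q ℕ.^ m ∸ d)             ≈⟨ *-congʳ u^d≈0 ⟩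
            0# * (y - 1#) ^ (q ℕ.^ m ∸ d)                       ≈⟨ zeroˡ _ ⟩
            0#                                                  ∎

-- Iterates of an endomorphism and the cyclic modules it generates.

module Endomorphisms where

  open import Algebra.Bundles using (AbelianGroup; CommutativeRing)
  import Algebra.Definitions.RawMonoid
  import Algebra.Properties.Group
  import Algebra.Properties.Semiring.Exp
  import Algebra.Properties.Semiring.Mult
  open import Data.Fin as Fin using (Fin; toℕ; funToFin; finToFun)
  import Data.Fin.Properties as Finₚ
  open import Data.Nat as ℕ using (ℕ; zero; suc; _≤_; _∸_)
  open import Data.Nat.Divisibility using (_∣_; divides-refl)
  open import Data.Nat.GCD using (gcd; gcd-GCD; module Bézout)
  open import Data.Nat.Primality using (Prime)
  import Data.Nat.Properties as ℕₚ
  open import Data.Product using (∃; ∃₂; _,_; proj₁; proj₂) renaming (_×_ to _∧_)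
  open import Data.Sum using (_⊎_)
  open import Data.Vec using (tabulate)
  import Data.Vec.Relation.Unary.All.Properties as Allₚ
  import Data.Vec.Relation.Unary.Any.Properties as Anyₚ
  open import Relation.Binary.PropositionalEquality as ≡ using (_≡_; _≢_; _≗_; cong; cong₂; subst)
  open Arithmetic
  open PolynomialRoots

  iter : ∀ {a} {A : Set a} → (A → A) → ℕ → A → A
  iter T zero    u = u
  iter T (suc k) u = T (iter T k u)

  iter-+ : ∀ {a} {A : Set a} (T : A → A) k l u → iter T (k ℕ.+ l) u ≡ iter T k (iter T l u)
  iter-+ T zero    l u = ≡.refl
  iter-+ T (suc k) l u = ≡.cong T (iter-+ T k l u)

  iter-* : ∀ {a} {A : Set a} (T : A → A) k l u → iter T (k ℕ.* l) u ≡ iter (iter T l) k u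
  iter-* T zero    l u = ≡.refl
  iter-* T (suc k) l u = ≡.trans (iter-+ T l (k ℕ.* l) u) (≡.cong (iter T l) (iter-* T k l u))

  -- Formal expressions, later identified when they agree on one vector. Multiplication is read as
  -- composition, so its associativity and unit laws hold by `refl`, and commutativity reduces to
  -- the fact that every expression commutes with T.
  data Poly : Set where
    :X :0 :1  : Poly
    _:+_ _:*_ : Poly → Poly → Poly
    :-_       : Poly → Poly

  module _ {c ℓ} (G : AbelianGroup c ℓ) where

    open AbelianGroup G

    module Endomorphism
      (T : Carrier → Carrier)
      (T-cong : ∀ {u w} → u ≈ w → T u ≈ T w)
      (T-homo : ∀ u w → T (u ∙ w) ≈ T u ∙ T w)
      where

      open import Algebra.Properties.AbelianGroup G
      open import Algebra.Properties.CommutativeSemigroup commutativeSemigroup using (interchange)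
      open import Relation.Binary.Reasoning.Setoid setoid

      Fixes : ℕ → Set _
      Fixes k = ∀ u → iter T k u ≈ u

      iter-cong : ∀ k {u w} → u ≈ w → iter T k u ≈ iter T k w
      iter-cong zero    u≈w = u≈w
      iter-cong (suc k) u≈w = T-cong (iter-cong k u≈w)

      fixes-* : ∀ {k} → Fixes k → ∀ t → Fixes (t ℕ.* k)
      fixes-* h zero    u = refl
      fixes-* {k} h (suc t) u = begin
        iter T (k ℕ.+ t ℕ.* k) u          ≡⟨ iter-+ T k (t ℕ.* k) u ⟩
        iter T k (iter T (t ℕ.* k) u)     ≈⟨ h _ ⟩
        iter T (t ℕ.* k) u                ≈⟨ fixes-* h t u ⟩
        u                                 ∎

      fixes-∣ : ∀ {k l} → k ∣ l → Fixes k → Fixes l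
      fixes-∣ (divides-refl t) h = fixes-* h t

      -- Bézout over ℕ keeps all exponents nonnegative: padding u by y l iterations turns gcd k l
      -- into x k.
      fixes-gcd : ∀ k l → Fixes k → Fixes l → Fixes (gcd k l)
      fixes-gcd k l hk hl u with Bézout.identity (gcd-GCD k l)
      ... | Bézout.+- x y eq = begin
        iter T (gcd k l) u                          ≈⟨ iter-cong (gcd k l) (fixes-* hl y u) ⟨
        iter T (gcd k l) (iter T (y ℕ.* l) u)       ≡⟨ ≡.sym (iter-+ T (gcd k l) (y ℕ.* l) u) ⟩
        iter T (gcd k l ℕ.+ y ℕ.* l) u              ≡⟨ ≡.cong (λ t → iter T t u) eq ⟩
        iter T (x ℕ.* k) u                          ≈⟨ fixes-* hk x u ⟩
        u                                           ∎
      ... | Bézout.-+ x y eq = begin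
        iter T (gcd k l) u                          ≈⟨ iter-cong (gcd k l) (fixes-* hk x u) ⟨
        iter T (gcd k l) (iter T (x ℕ.* k) u)       ≡⟨ ≡.sym (iter-+ T (gcd k l) (x ℕ.* k) u) ⟩
        iter T (gcd k l ℕ.+ x ℕ.* k) u              ≡⟨ ≡.cong (λ t → iter T t u) eq ⟩
        iter T (y ℕ.* l) u                          ≈⟨ fixes-* hl y u ⟩
        u                                           ∎

      T-ε : T ε ≈ ε
      T-ε = identityˡ-unique (T ε) (T ε) (trans (sym (T-homo ε ε)) (T-cong (identityˡ ε)))

      T-⁻¹ : ∀ u → T (u ⁻¹) ≈ T u ⁻¹
      T-⁻¹ u = inverseʳ-unique (T u) (T (u ⁻¹)) (trans (sym (T-homo u (u ⁻¹))) (trans (T-cong (inverseʳ u)) T-ε))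

      ⟦_⟧ : Poly → Carrier → Carrier
      ⟦ :X ⟧     w = T w
      ⟦ :0 ⟧     w = ε
      ⟦ :1 ⟧     w = w
      ⟦ e :+ f ⟧ w = ⟦ e ⟧ w ∙ ⟦ f ⟧ w
      ⟦ e :* f ⟧ w = ⟦ e ⟧ (⟦ f ⟧ w)
      ⟦ :- e ⟧   w = ⟦ e ⟧ w ⁻¹

      ⟦⟧-cong : ∀ e {u w} → u ≈ w → ⟦ e ⟧ u ≈ ⟦ e ⟧ w
      ⟦⟧-cong :X       u≈w = T-cong u≈w
      ⟦⟧-cong :0       u≈w = refl
      ⟦⟧-cong :1       u≈w = u≈w
      ⟦⟧-cong (e :+ f) u≈w = ∙-cong (⟦⟧-cong e u≈w) (⟦⟧-cong f u≈w)
      ⟦⟧-cong (e :* f) u≈w = ⟦⟧-cong e (⟦⟧-cong f u≈w)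
      ⟦⟧-cong (:- e)   u≈w = ⁻¹-cong (⟦⟧-cong e u≈w)

      ⟦⟧-homo : ∀ e u w → ⟦ e ⟧ (u ∙ w) ≈ ⟦ e ⟧ u ∙ ⟦ e ⟧ w
      ⟦⟧-homo :X       u w = T-homo u w
      ⟦⟧-homo :0       u w = sym (identityˡ ε)
      ⟦⟧-homo :1       u w = refl
      ⟦⟧-homo (e :+ f) u w = trans (∙-cong (⟦⟧-homo e u w) (⟦⟧-homo f u w)) (interchange _ _ _ _)
      ⟦⟧-homo (e :* f) u w = trans (⟦⟧-cong e (⟦⟧-homo f u w)) (⟦⟧-homo e _ _)
      ⟦⟧-homo (:- e)   u w = trans (⁻¹-cong (⟦⟧-homo e u w)) (sym (⁻¹-∙-comm _ _))

      ⟦⟧-ε : ∀ e → ⟦ e ⟧ ε ≈ ε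
      ⟦⟧-ε e = identityˡ-unique _ _ (trans (sym (⟦⟧-homo e ε ε)) (⟦⟧-cong e (identityˡ ε)))

      ⟦⟧-⁻¹ : ∀ e u → ⟦ e ⟧ (u ⁻¹) ≈ ⟦ e ⟧ u ⁻¹
      ⟦⟧-⁻¹ e u = inverseʳ-unique _ _
        (trans (sym (⟦⟧-homo e u (u ⁻¹))) (trans (⟦⟧-cong e (inverseʳ u)) (⟦⟧-ε e)))

      ⟦⟧-T-comm : ∀ f w → ⟦ f ⟧ (T w) ≈ T (⟦ f ⟧ w)
      ⟦⟧-T-comm :X       w = refl
      ⟦⟧-T-comm :0       w = sym T-ε
      ⟦⟧-T-comm :1       w = refl
      ⟦⟧-T-comm (e :+ f) w = trans (∙-cong (⟦⟧-T-comm e w) (⟦⟧-T-comm f w)) (sym (T-homo _ _))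
      ⟦⟧-T-comm (e :* f) w = trans (⟦⟧-cong e (⟦⟧-T-comm f w)) (⟦⟧-T-comm e _)
      ⟦⟧-T-comm (:- e)   w = trans (⁻¹-cong (⟦⟧-T-comm e w)) (sym (T-⁻¹ _))

      ⟦⟧-comm : ∀ e f w → ⟦ e ⟧ (⟦ f ⟧ w) ≈ ⟦ f ⟧ (⟦ e ⟧ w)
      ⟦⟧-comm :X       f w = sym (⟦⟧-T-comm f w)
      ⟦⟧-comm :0       f w = sym (⟦⟧-ε f)
      ⟦⟧-comm :1       f w = refl
      ⟦⟧-comm (d :+ e) f w = trans (∙-cong (⟦⟧-comm d f w) (⟦⟧-comm e f w)) (sym (⟦⟧-homo f _ _))
      ⟦⟧-comm (d :* e) f w = trans (⟦⟧-cong d (⟦⟧-comm e f w)) (⟦⟧-comm d f _)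
      ⟦⟧-comm (:- e)   f w = trans (⁻¹-cong (⟦⟧-comm e f w)) (sym (⟦⟧-⁻¹ f _))

      -- ℤ[X] modulo the annihilator of v.
      cyclicRing : Carrier → CommutativeRing _ _
      cyclicRing v = record
        { Carrier = Poly
        ; _≈_ = λ e f → ⟦ e ⟧ v ≈ ⟦ f ⟧ v
        ; _+_ = _:+_
        ; _*_ = _:*_
        ; -_ = :-_
        ; 0# = :0
        ; 1# = :1
        ; isCommutativeRing = record
          { isRing = record
            { +-isAbelianGroup = record
              { isGroup = record
                { isMonoid = record
                  { isSemigroup = record
                    { isMagma = record
                      { isEquivalence = record { refl = refl ; sym = sym ; trans = trans }
                      ; ∙-cong = ∙-cong
                      }
                    ; assoc = λ e f g → assoc _ _ _
                    }
                  ; identity = (λ e → identityˡ _) , (λ e → identityʳ _)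
                  }
                ; inverse = (λ e → inverseˡ _) , (λ e → inverseʳ _)
                ; ⁻¹-cong = ⁻¹-cong
                }
              ; comm = λ e f → comm _ _
              }
            ; *-cong = λ {e} {e′} {f} {f′} e≈e′ f≈f′ →
                trans (⟦⟧-cong e f≈f′)
                  (trans (⟦⟧-comm e f′ v) (trans (⟦⟧-cong f′ e≈e′) (⟦⟧-comm f′ e′ v)))
            ; *-assoc = λ e f g → refl
            ; *-identity = (λ e → refl) , (λ e → refl)
            ; distrib = (λ e f g → ⟦⟧-homo e _ _) , (λ e f g → refl)
            }
          ; *-comm = λ e f → ⟦⟧-comm e f v
          }
        }

  funToFin-cong : ∀ {m n} {f g : Fin m → Fin n} → f ≗ g → funToFin f ≡ funToFin g
  funToFin-cong {zero}  h = ≡.refl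
  funToFin-cong {suc m} h = cong₂ Fin.combine (h Fin.zero) (funToFin-cong (λ i → h (Fin.suc i)))

  finToFun-≢ : ∀ {n m} {k l : Fin (n ℕ.^ m)} → k ≢ l → ∃ λ i → finToFun {n} {m} k i ≢ finToFun l i
  finToFun-≢ {n} {m} {k} {l} k≢l = Finₚ.¬∀⟶∃¬ m _ (λ i → finToFun k i Fin.≟ finToFun l i)
    (λ h → k≢l (≡.trans (≡.sym (Finₚ.funToFin-finToFin {m} k)) (≡.trans (funToFin-cong h) (Finₚ.funToFin-finToFin {m} l))))


  -- Two of the q^(m+1) polynomials of degree ≤ m with coefficients in [0, q) agree
  -- on v, because G has at most q^m elements.
  module _ {c ℓ} (G : AbelianGroup c ℓ) where

    open AbelianGroup G using (Carrier; _≈_; ε; _∙_; rawMonoid)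
    open Algebra.Definitions.RawMonoid rawMonoid using (_×_)

    module _
      (T : Carrier → Carrier)
      (T-cong : ∀ {u w} → u ≈ w → T u ≈ T w)
      (T-homo : ∀ u w → T (u ∙ w) ≈ T u ∙ T w)
      (T-injective : ∀ {w} → T w ≈ ε → w ≈ ε)
      {m q L : ℕ} (q-prime : Prime q) (L-mult : ∀ i → 1 ≤ i → i ≤ m → q ℕ.^ i ∸ 1 ∣ L)
      (q-torsion : ∀ u → q × u ≈ ε)
      (label : Carrier → Fin (q ℕ.^ m)) (label-injective : ∀ {u w} → label u ≡ label w → u ≈ w)
      where

      open Endomorphism G T T-cong T-homo

      exponent-bound : Fixes (L ℕ.* q ℕ.^ m ℕ.* q ℕ.^ m)
      exponent-bound v = collision (Finₚ.pigeonhole (ℕₚ.^-monoʳ-< q (prime⇒2≤ q-prime) (ℕₚ.n<1+n m)) (λ k → label (⟦ value k ⟧ v)))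
        where
        R : CommutativeRing _ _
        R = cyclicRing v
        module R = CommutativeRing R
        open R using (1#; _-_)
        open PrimeCharacteristic R q-prime
        open Algebra.Properties.Semiring.Exp R.semiring using (_^_)
        open Algebra.Properties.Semiring.Mult R.semiring using () renaming (_×_ to _×ᴿ_)
        open Algebra.Properties.Group R.+-group using (x≈y⇒x∙y⁻¹≈ε)

        ⟦×1⟧ : ∀ k → ⟦ k ×ᴿ 1# ⟧ v ≡ k × v
        ⟦×1⟧ zero    = ≡.refl
        ⟦×1⟧ (suc k) = cong (v ∙_) (⟦×1⟧ k)

        ⟦X^⟧ : ∀ k → ⟦ :X ^ k ⟧ v ≡ iter T k v
        ⟦X^⟧ zero    = ≡.refl
        ⟦X^⟧ (suc k) = cong T (⟦X^⟧ k)

        q×1≈0 : ⟦ q ×ᴿ 1# ⟧ v ≈ ε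
        q×1≈0 = subst (_≈ ε) (≡.sym (⟦×1⟧ q)) (q-torsion v)

        coeff : Fin (q ℕ.^ suc m) → Fin (suc m) → ℕ
        coeff k i = toℕ (finToFun {q} {suc m} k i)

        value : Fin (q ℕ.^ suc m) → Poly
        value k = evalPoly (tabulate (λ i → coeff k i ×ᴿ 1#)) :X

        collision : (∃₂ λ k l → k Fin.< l ∧ label (⟦ value k ⟧ v) ≡ label (⟦ value l ⟧ v)) →
                    iter T (L ℕ.* q ℕ.^ m ℕ.* q ℕ.^ m) v ≈ v
        collision (k , l , k<l , eq) with finToFun-≢ {q} {suc m} (Finₚ.<⇒≢ k<l)
        -- The difference of the two colliding polynomials has `:X` as a root, because both have the
        -- same value on v. Its coefficient at the digit j where k and l differ is regular, and `:X`
        -- itself is regular because T has trivial kernel.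
        ... | j , cₖ≢cₗ = subst (_≈ v) (⟦X^⟧ (L ℕ.* q ℕ.^ m ℕ.* q ℕ.^ m)) (root⇒unipotent q×1≈0 {m} {L} L-mult :X (λ _ → T-injective) ℕₚ.≤-refl
              (Allₚ.tabulate⁺ {f = c′} (λ i → difference-fixed q×1≈0 (×1-fixed q×1≈0 (coeff k i)) (×1-fixed q×1≈0 (coeff l i))))
              (Allₚ.tabulate⁺ {f = c′} (λ i → proj₁ (diff i)))
              (Anyₚ.tabulate⁺ {f = c′} j (proj₂ (diff j) (λ e → cₖ≢cₗ (Finₚ.toℕ-injective e))))
              (R.trans {evalPoly (tabulate c′) :X} {value k - value l} {R.0#} (evalPoly-- (λ i → coeff k i ×ᴿ 1#) (λ i → coeff l i ×ᴿ 1#) :X)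
                (x≈y⇒x∙y⁻¹≈ε {value k} {value l} (label-injective eq))))
          where
          c′ : Fin (suc m) → Poly
          c′ i = coeff k i ×ᴿ 1# - coeff l i ×ᴿ 1#
          diff : ∀ i → (c′ i R.≈ R.0# ⊎ Regular (c′ i)) ∧ (coeff k i ≢ coeff l i → Regular (c′ i))
          diff i = ×1-difference q×1≈0 (coeff k i) (coeff l i)
            (Finₚ.toℕ<n (finToFun {q} {suc m} k i)) (Finₚ.toℕ<n (finToFun {q} {suc m} l i))

-- Integer matrices acting on vectors modulo N.

module Matrices where

  open import Algebra.Bundles using (AbelianGroup)
  import Algebra.Definitions.RawMonoid
  open import Data.Fin as Fin using (Fin; toℕ; fromℕ<; funToFin; finToFun; _≟_)
  open import Data.Fin.Patterns using (0F)
  import Data.Fin.Properties as Finₚ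
  open import Data.Integer as ℤ using (ℤ; +_; 0ℤ)
  open import Data.Integer.Divisibility.Signed as ℤS using (divides)
  open import Data.Integer.DivMod using (_%ℕ_; _/ℕ_; n%ℕd<d; a≡a%ℕn+[a/ℕn]*n)
  import Data.Integer.Properties as ℤₚ
  open import Data.Integer.Tactic.RingSolver using (solve-∀)
  open import Data.Nat as ℕ using (ℕ; zero; suc; _≤_; _∸_)
  open import Data.Nat.Divisibility using (_∣_)
  open import Data.Nat.Primality using (Prime)
  import Data.Nat.Properties as ℕₚ
  open import Data.Product using (_,_)
  open import Level using (0ℓ)
  open import Relation.Binary.PropositionalEquality
  open import Relation.Nullary using (yes; no)
  open import Defs
  open Arithmetic
  open Endomorphisms

  Vector : ℕ → Set
  Vector m = Fin m → ℤ

  record _≈[_]_ {m} (u : Vector m) (N : ℕ) (w : Vector m) : Set where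
    constructor mod
    field
      at : ∀ i → + N ℤS.∣ u i ℤ.- w i

  open _≈[_]_

  _⊕_ : ∀ {m} → Vector m → Vector m → Vector m
  (u ⊕ w) i = u i ℤ.+ w i

  _·_ : ∀ {m} → ℤ → Vector m → Vector m
  (a · u) i = a ℤ.* u i

  infix 4 _≈[_]_
  infixl 6 _⊕_
  infixl 7 _·_

  ≗⇒≈ : ∀ {m N} {u w : Vector m} → u ≗ w → u ≈[ N ] w
  ≗⇒≈ {w = w} u≗w .at i rewrite u≗w i | ℤₚ.+-inverseʳ (w i) = divides 0ℤ refl

  ≈-sym : ∀ {m N} {u w : Vector m} → u ≈[ N ] w → w ≈[ N ] u
  ≈-sym {N = N} {u} {w} h .at i = subst (+ N ℤS.∣_) (lemma (u i) (w i)) (ℤS.∣m⇒∣-m (at h i))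
    where
    lemma : ∀ a b → ℤ.- (a ℤ.- b) ≡ b ℤ.- a
    lemma = solve-∀

  ≈-trans : ∀ {m N} {u v w : Vector m} → u ≈[ N ] v → v ≈[ N ] w → u ≈[ N ] w
  ≈-trans {N = N} {u} {v} {w} h k .at i = subst (+ N ℤS.∣_) (lemma (u i) (v i) (w i)) (ℤS.∣m∣n⇒∣m+n (at h i) (at k i))
    where
    lemma : ∀ a b c → (a ℤ.- b) ℤ.+ (b ℤ.- c) ≡ a ℤ.- c
    lemma = solve-∀

  ⊕-cong : ∀ {m N} {u u′ w w′ : Vector m} → u ≈[ N ] u′ → w ≈[ N ] w′ → u ⊕ w ≈[ N ] u′ ⊕ w′
  ⊕-cong {N = N} {u} {u′} {w} {w′} h k .at i =
    subst (+ N ℤS.∣_) (lemma (u i) (u′ i) (w i) (w′ i)) (ℤS.∣m∣n⇒∣m+n (at h i) (at k i))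
    where
    lemma : ∀ a a′ b b′ → (a ℤ.- a′) ℤ.+ (b ℤ.- b′) ≡ (a ℤ.+ b) ℤ.- (a′ ℤ.+ b′)
    lemma = solve-∀

  modVector : ℕ → ℕ → AbelianGroup 0ℓ 0ℓ
  modVector m N = record
    { Carrier = Vector m
    ; _≈_ = _≈[ N ]_
    ; _∙_ = _⊕_
    ; ε = λ _ → 0ℤ
    ; _⁻¹ = λ u i → ℤ.- u i
    ; isAbelianGroup = record
      { isGroup = record
        { isMonoid = record
          { isSemigroup = record
            { isMagma = record
              { isEquivalence = record { refl = ≗⇒≈ (λ _ → refl) ; sym = ≈-sym ; trans = ≈-trans }
              ; ∙-cong = ⊕-cong
              }
            ; assoc = λ u v w → ≗⇒≈ (λ i → ℤₚ.+-assoc (u i) (v i) (w i))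
            }
          ; identity = (λ u → ≗⇒≈ (λ i → ℤₚ.+-identityˡ (u i))) , (λ u → ≗⇒≈ (λ i → ℤₚ.+-identityʳ (u i)))
          }
        ; inverse = (λ u → ≗⇒≈ (λ i → ℤₚ.+-inverseˡ (u i))) , (λ u → ≗⇒≈ (λ i → ℤₚ.+-inverseʳ (u i)))
        ; ⁻¹-cong = λ {u} {w} h → mod λ i → subst (+ N ℤS.∣_) (ℤₚ.neg-distrib-+ (u i) (ℤ.- w i)) (ℤS.∣m⇒∣-m (at h i))
        }
      ; comm = λ u w → ≗⇒≈ (λ i → ℤₚ.+-comm (u i) (w i))
      }
    }

  -- Linearity is exact over ℤ, because one and the same map is read modulo several numbers, and
  -- lifting from a to q a needs the true quotient of S u - u by a.
  record IsLinear {m} (T : Vector m → Vector m) : Set where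
    field
      ≗-cong : ∀ {u w} → u ≗ w → T u ≗ T w
      add    : ∀ u w → T (u ⊕ w) ≗ T u ⊕ T w
      scale  : ∀ a u → T (a · u) ≗ a · T u

    ≈-cong : ∀ {N u w} → u ≈[ N ] w → T u ≈[ N ] T w
    ≈-cong {N} {u} {w} h .at i = divides (T t i) (begin
      T u i ℤ.- T w i                         ≡⟨ cong (ℤ._- T w i) (≗-cong u≗ i) ⟩
      T (w ⊕ + N · t) i ℤ.- T w i             ≡⟨ cong (ℤ._- T w i) (add w (+ N · t) i) ⟩
      T w i ℤ.+ T (+ N · t) i ℤ.- T w i       ≡⟨ cong (λ z → T w i ℤ.+ z ℤ.- T w i) (scale (+ N) t i) ⟩
      T w i ℤ.+ + N ℤ.* T t i ℤ.- T w i       ≡⟨ lemma₂ (T w i) (+ N) (T t i) ⟩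
      T t i ℤ.* + N                           ∎)
      where
      open ≡-Reasoning
      t : Vector _
      t j = ℤS._∣_.quotient (at h j)
      lemma₁ : ∀ a b → a ≡ b ℤ.+ (a ℤ.- b)
      lemma₁ = solve-∀
      lemma₂ : ∀ a b c → a ℤ.+ b ℤ.* c ℤ.- a ≡ c ℤ.* b
      lemma₂ = solve-∀
      u≗ : u ≗ w ⊕ + N · t
      u≗ j = trans (lemma₁ (u j) (w j)) (cong (ℤ._+_ (w j)) (trans (ℤS._∣_.equality (at h j)) (ℤₚ.*-comm (t j) (+ N))))

  iter-linear : ∀ {m} {T : Vector m → Vector m} → IsLinear T → ∀ k → IsLinear (iter T k)
  iter-linear lin zero = record { ≗-cong = λ h → h ; add = λ _ _ _ → refl ; scale = λ _ _ _ → refl }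
  iter-linear {T = T} lin (suc k) = record
    { ≗-cong = λ h → L.≗-cong (K.≗-cong h)
    ; add    = λ u w i → trans (L.≗-cong (K.add u w) i) (L.add _ _ i)
    ; scale  = λ a u i → trans (L.≗-cong (K.scale a u) i) (L.scale a _ i)
    }
    where
    module L = IsLinear lin
    module K = IsLinear (iter-linear lin k)

  -- S^q − 1 = (S − 1)(1 + S + ⋯ + S^(q−1)): the first factor is divisible by a, the second by q.
  module _ {m a q} {S : Vector m → Vector m} (lin : IsLinear S)
           (S≈a : ∀ u → S u ≈[ a ] u) (S≈q : ∀ u → S u ≈[ q ] u) where

    open IsLinear lin

    private
      module _ (u : Vector m) where
        t : Vector m
        t j = ℤS._∣_.quotient (at (S≈a u) j)

        -- Horner form of (1 + S + ⋯ + S^(k-1)) t, where S u = u + a t. Modulo q each of the k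
        -- summands is t, so the q-th sum is divisible by q.
        geom : ℕ → Vector m
        geom zero    = λ _ → 0ℤ
        geom (suc k) = t ⊕ S (geom k)

        Su≗ : S u ≗ u ⊕ + a · t
        Su≗ j = trans (lemma (S u j) (u j)) (cong (ℤ._+_ (u j)) (trans (ℤS._∣_.equality (at (S≈a u) j)) (ℤₚ.*-comm (t j) (+ a))))
          where
          lemma : ∀ x y → x ≡ y ℤ.+ (x ℤ.- y)
          lemma = solve-∀

        iter≗ : ∀ k → iter S k u ≗ u ⊕ + a · geom k
        iter≗ zero    j = sym (trans (cong (ℤ._+_ (u j)) (ℤₚ.*-zeroʳ (+ a))) (ℤₚ.+-identityʳ (u j)))
        iter≗ (suc k) j = begin
          S (iter S k u) j                              ≡⟨ ≗-cong (iter≗ k) j ⟩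
          S (u ⊕ + a · geom k) j                        ≡⟨ add u (+ a · geom k) j ⟩
          S u j ℤ.+ S (+ a · geom k) j                  ≡⟨ cong₂ ℤ._+_ (Su≗ j) (scale (+ a) (geom k) j) ⟩
          u j ℤ.+ + a ℤ.* t j ℤ.+ + a ℤ.* S (geom k) j  ≡⟨ lemma (u j) (+ a) (t j) (S (geom k) j) ⟩
          u j ℤ.+ + a ℤ.* (t j ℤ.+ S (geom k) j)        ∎
          where
          open ≡-Reasoning
          lemma : ∀ x y z w → x ℤ.+ y ℤ.* z ℤ.+ y ℤ.* w ≡ x ℤ.+ y ℤ.* (z ℤ.+ w)
          lemma = solve-∀

        geom≈ : ∀ k → geom k ≈[ q ] + k · t
        geom≈ zero    = ≗⇒≈ (λ j → sym (ℤₚ.*-zeroˡ (t j)))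
        geom≈ (suc k) = ≈-trans (⊕-cong (≗⇒≈ {u = t} (λ _ → refl)) (≈-trans (S≈q (geom k)) (geom≈ k)))
          (≗⇒≈ (λ j → sym (ℤₚ.suc-* (+ k) (t j))))

        q∣geom : ∀ j → + q ℤS.∣ geom q j
        q∣geom j = subst (+ q ℤS.∣_) (lemma (geom q j) (+ q ℤ.* t j))
          (ℤS.∣m∣n⇒∣m+n (at (geom≈ q) j) (ℤS.∣m⇒∣m*n (t j) ℤS.∣-refl))
          where
          lemma : ∀ x y → x ℤ.- y ℤ.+ y ≡ x
          lemma = solve-∀

    iter-lift : ∀ u → iter S q u ≈[ q ℕ.* a ] u
    iter-lift u .at j = divides r (begin
      iter S q u j ℤ.- u j                        ≡⟨ cong (ℤ._- u j) (iter≗ u q j) ⟩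
      u j ℤ.+ + a ℤ.* geom u q j ℤ.- u j          ≡⟨ cong (λ z → u j ℤ.+ + a ℤ.* z ℤ.- u j) (ℤS._∣_.equality (q∣geom u j)) ⟩
      u j ℤ.+ + a ℤ.* (r ℤ.* + q) ℤ.- u j         ≡⟨ lemma (u j) (+ a) r (+ q) ⟩
      r ℤ.* (+ q ℤ.* + a)                         ≡⟨ cong (r ℤ.*_) (sym (ℤₚ.pos-* q a)) ⟩
      r ℤ.* + (q ℕ.* a)                           ∎)
      where
      open ≡-Reasoning
      r : ℤ
      r = ℤS._∣_.quotient (q∣geom u j)
      lemma : ∀ x y z w → x ℤ.+ y ℤ.* (z ℤ.* w) ℤ.- x ≡ z ℤ.* (w ℤ.* y)
      lemma = solve-∀

  sumFin-cong : ∀ m {f g : Fin m → ℤ} → f ≗ g → sumFin m f ≡ sumFin m g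
  sumFin-cong zero    h = refl
  sumFin-cong (suc m) h = cong₂ ℤ._+_ (h 0F) (sumFin-cong m (λ i → h (Fin.suc i)))

  sumFin-zero : ∀ m → sumFin m (λ _ → 0ℤ) ≡ 0ℤ
  sumFin-zero zero    = refl
  sumFin-zero (suc m) = trans (ℤₚ.+-identityˡ _) (sumFin-zero m)

  sumFin-+ : ∀ m (f g : Fin m → ℤ) → sumFin m (λ i → f i ℤ.+ g i) ≡ sumFin m f ℤ.+ sumFin m g
  sumFin-+ zero    f g = refl
  sumFin-+ (suc m) f g = trans (cong (ℤ._+_ (f 0F ℤ.+ g 0F)) (sumFin-+ m _ _)) (lemma (f 0F) (g 0F) _ _)
    where
    lemma : ∀ a b c d → a ℤ.+ b ℤ.+ (c ℤ.+ d) ≡ a ℤ.+ c ℤ.+ (b ℤ.+ d)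
    lemma = solve-∀

  sumFin-*ˡ : ∀ m a (f : Fin m → ℤ) → sumFin m (λ i → a ℤ.* f i) ≡ a ℤ.* sumFin m f
  sumFin-*ˡ zero    a f = sym (ℤₚ.*-zeroʳ a)
  sumFin-*ˡ (suc m) a f = trans (cong (ℤ._+_ (a ℤ.* f 0F)) (sumFin-*ˡ m a _)) (sym (ℤₚ.*-distribˡ-+ a (f 0F) _))

  sumFin-swap : ∀ m n (f : Fin m → Fin n → ℤ) →
    sumFin m (λ i → sumFin n (f i)) ≡ sumFin n (λ j → sumFin m (λ i → f i j))
  sumFin-swap zero    n f = sym (sumFin-zero n)
  sumFin-swap (suc m) n f = trans (cong (ℤ._+_ (sumFin n (f 0F))) (sumFin-swap m n _)) (sym (sumFin-+ n (f 0F) _))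

  apply : ∀ {m} → Mat m → Vector m → Vector m
  apply {m} A u i = sumFin m (λ k → A i k ℤ.* u k)

  apply-linear : ∀ {m} (A : Mat m) → IsLinear (apply A)
  apply-linear {m} A = record
    { ≗-cong = λ h i → sumFin-cong m (λ k → cong (A i k ℤ.*_) (h k))
    ; add    = λ u w i → trans (sumFin-cong m (λ k → ℤₚ.*-distribˡ-+ (A i k) (u k) (w k))) (sumFin-+ m _ _)
    ; scale  = λ a u i → trans (sumFin-cong m (λ k → lemma (A i k) a (u k))) (sumFin-*ˡ m a _)
    }
    where
    lemma : ∀ x y z → x ℤ.* (y ℤ.* z) ≡ y ℤ.* (x ℤ.* z)
    lemma = solve-∀

  apply-⊗ : ∀ {m} (A B : Mat m) u → apply (A ⊗ B) u ≗ apply A (apply B u)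
  apply-⊗ {m} A B u i = begin
    sumFin m (λ k → sumFin m (λ l → A i l ℤ.* B l k) ℤ.* u k)
      ≡⟨ sumFin-cong m (λ k → trans (ℤₚ.*-comm _ (u k)) (trans (sym (sumFin-*ˡ m (u k) _))
           (sumFin-cong m (λ l → lemma (u k) (A i l) (B l k))))) ⟩
    sumFin m (λ k → sumFin m (λ l → A i l ℤ.* (B l k ℤ.* u k)))
      ≡⟨ sumFin-swap m m _ ⟩
    sumFin m (λ l → sumFin m (λ k → A i l ℤ.* (B l k ℤ.* u k)))
      ≡⟨ sumFin-cong m (λ l → sumFin-*ˡ m (A i l) _) ⟩
    sumFin m (λ l → A i l ℤ.* sumFin m (λ k → B l k ℤ.* u k)) ∎
    where
    open ≡-Reasoning
    lemma : ∀ x y z → x ℤ.* (y ℤ.* z) ≡ y ℤ.* (z ℤ.* x)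
    lemma = solve-∀

  idMat-suc : ∀ {m} (i j : Fin m) → idMat (Fin.suc i) (Fin.suc j) ≡ idMat i j
  idMat-suc i j with i ≟ j
  ... | yes _ = refl
  ... | no  _ = refl

  apply-idMat : ∀ {m} (u : Vector m) → apply idMat u ≗ u
  apply-idMat {suc m} u 0F = trans (cong₂ ℤ._+_ (ℤₚ.*-identityˡ (u 0F))
    (trans (sumFin-cong m (λ k → ℤₚ.*-zeroˡ (u (Fin.suc k)))) (sumFin-zero m))) (ℤₚ.+-identityʳ (u 0F))
  apply-idMat {suc m} u (Fin.suc i) = trans (cong₂ ℤ._+_ (ℤₚ.*-zeroˡ (u 0F))
    (trans (sumFin-cong m (λ k → cong (ℤ._* u (Fin.suc k)) (idMat-suc i k))) (apply-idMat (λ k → u (Fin.suc k)) i)))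
    (ℤₚ.+-identityˡ _)

  sumFin-∣ : ∀ m {d} (f : Fin m → ℤ) → (∀ i → d ℤS.∣ f i) → d ℤS.∣ sumFin m f
  sumFin-∣ zero    f h = divides 0ℤ refl
  sumFin-∣ (suc m) f h = ℤS.∣m∣n⇒∣m+n (h 0F) (sumFin-∣ m _ (λ i → h (Fin.suc i)))

  apply-≡mod : ∀ {m N} {A B : Mat m} → A ≡[mod N ] B → ∀ u → apply A u ≈[ N ] apply B u
  apply-≡mod {m} {N} {A} {B} h u .at i = subst (+ N ℤS.∣_) eq
    (sumFin-∣ m (λ k → (A i k ℤ.- B i k) ℤ.* u k) (λ k → ℤS.∣m⇒∣m*n {m = A i k ℤ.- B i k} (u k) (ℤS.∣ᵤ⇒∣ (h i k))))
    where
    open ≡-Reasoning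
    lemma₁ : ∀ a b c → (a ℤ.- b) ℤ.* c ≡ a ℤ.* c ℤ.+ ℤ.-1ℤ ℤ.* (b ℤ.* c)
    lemma₁ = solve-∀
    lemma₂ : ∀ a b → a ℤ.+ ℤ.-1ℤ ℤ.* b ≡ a ℤ.- b
    lemma₂ = solve-∀
    eq : sumFin m (λ k → (A i k ℤ.- B i k) ℤ.* u k) ≡ apply A u i ℤ.- apply B u i
    eq = begin
      sumFin m (λ k → (A i k ℤ.- B i k) ℤ.* u k)                                 ≡⟨ sumFin-cong m (λ k → lemma₁ (A i k) (B i k) (u k)) ⟩
      sumFin m (λ k → A i k ℤ.* u k ℤ.+ ℤ.-1ℤ ℤ.* (B i k ℤ.* u k))              ≡⟨ sumFin-+ m _ _ ⟩
      apply A u i ℤ.+ sumFin m (λ k → ℤ.-1ℤ ℤ.* (B i k ℤ.* u k))                ≡⟨ cong (ℤ._+_ (apply A u i)) (sumFin-*ˡ m ℤ.-1ℤ _) ⟩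
      apply A u i ℤ.+ ℤ.-1ℤ ℤ.* apply B u i                                      ≡⟨ lemma₂ (apply A u i) (apply B u i) ⟩
      apply A u i ℤ.- apply B u i                                                ∎

  apply-matPow : ∀ {m} (A : Mat m) k u → apply (matPow A k) u ≗ iter (apply A) k u
  apply-matPow A zero    u i = apply-idMat u i
  apply-matPow A (suc k) u i = trans (apply-⊗ A (matPow A k) u i) (IsLinear.≗-cong (apply-linear A) (apply-matPow A k u) i)

  -- The columns of the identity are the basis vectors; this recovers a matrix congruence from the
  -- action on vectors.
  matPow-column : ∀ {m} (A : Mat m) k j → (λ i → matPow A k i j) ≗ iter (apply A) k (λ i → idMat i j)
  matPow-column A zero    j i = refl
  matPow-column A (suc k) j i = IsLinear.≗-cong (apply-linear A) (matPow-column A k j) i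

  FixesMod : ∀ {m} → Mat m → ℕ → ℕ → Set
  FixesMod A N k = ∀ u → iter (apply A) k u ≈[ N ] u

  matPow≡id⇒fixes : ∀ {m N} (A : Mat m) k → matPow A k ≡[mod N ] idMat → FixesMod A N k
  matPow≡id⇒fixes A k h u = ≈-trans (≗⇒≈ (λ i → sym (apply-matPow A k u i)))
    (≈-trans (apply-≡mod {A = matPow A k} {B = idMat} h u) (≗⇒≈ (apply-idMat u)))

  fixes⇒matPow≡id : ∀ {m N} (A : Mat m) k → FixesMod A N k → matPow A k ≡[mod N ] idMat
  fixes⇒matPow≡id A k h i j = ℤS.∣⇒∣ᵤ (at (≈-trans (≗⇒≈ (matPow-column A k j)) (h (λ l → idMat l j))) i)

  residue : ∀ q .{{_ : ℕ.NonZero q}} → ℤ → Fin q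
  residue q z = fromℕ< (n%ℕd<d z q)

  residue-≡⇒∣ : ∀ q .{{_ : ℕ.NonZero q}} y z → residue q y ≡ residue q z → + q ℤS.∣ y ℤ.- z
  residue-≡⇒∣ q y z eq = divides (y /ℕ q ℤ.- z /ℕ q) (begin
    y ℤ.- z
      ≡⟨ cong₂ ℤ._-_ (a≡a%ℕn+[a/ℕn]*n y q) (a≡a%ℕn+[a/ℕn]*n z q) ⟩
    + (y %ℕ q) ℤ.+ y /ℕ q ℤ.* + q ℤ.- (+ (z %ℕ q) ℤ.+ z /ℕ q ℤ.* + q)
      ≡⟨ cong (λ r → + r ℤ.+ y /ℕ q ℤ.* + q ℤ.- (+ (z %ℕ q) ℤ.+ z /ℕ q ℤ.* + q)) %≡ ⟩
    + (z %ℕ q) ℤ.+ y /ℕ q ℤ.* + q ℤ.- (+ (z %ℕ q) ℤ.+ z /ℕ q ℤ.* + q)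
      ≡⟨ lemma (+ (z %ℕ q)) (y /ℕ q) (z /ℕ q) (+ q) ⟩
    (y /ℕ q ℤ.- z /ℕ q) ℤ.* + q ∎)
    where
    open ≡-Reasoning
    %≡ : y %ℕ q ≡ z %ℕ q
    %≡ = trans (sym (Finₚ.toℕ-fromℕ< _)) (trans (cong toℕ eq) (Finₚ.toℕ-fromℕ< _))
    lemma : ∀ r s t q → r ℤ.+ s ℤ.* q ℤ.- (r ℤ.+ t ℤ.* q) ≡ (s ℤ.- t) ℤ.* q
    lemma = solve-∀


  module ModAction {m} (A : Mat m) (N : ℕ) =
    Endomorphism (modVector m N) (apply A) (IsLinear.≈-cong (apply-linear A))
      (λ u w → ≗⇒≈ (IsLinear.add (apply-linear A) u w))

  module _ {m q L : ℕ} (q-prime : Prime q) (A B : Mat m) (BA≡1 : (B ⊗ A) ≡[mod q ] idMat)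
           (L-mult : ∀ i → 1 ≤ i → i ≤ m → q ℕ.^ i ∸ 1 ∣ L) where

    private
      instance
        q≢0 : ℕ.NonZero q
        q≢0 = ℕ.>-nonZero (ℕₚ.<⇒≤ (prime⇒2≤ q-prime))

      open Algebra.Definitions.RawMonoid (AbelianGroup.rawMonoid (modVector m q)) using (_×_)

      ×≗ : ∀ k (u : Vector m) → k × u ≗ + k · u
      ×≗ zero    u i = refl
      ×≗ (suc k) u i = trans (cong (ℤ._+_ (u i)) (×≗ k u i)) (sym (ℤₚ.suc-* (+ k) (u i)))

      q-torsion : ∀ u → q × u ≈[ q ] (λ _ → 0ℤ)
      q-torsion u .at i = divides (u i) (trans (ℤₚ.+-identityʳ _) (trans (×≗ q u i) (ℤₚ.*-comm (+ q) (u i))))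

      -- Applying the left inverse B returns w from A w.
      A-injective : ∀ {w} → apply A w ≈[ q ] (λ _ → 0ℤ) → w ≈[ q ] (λ _ → 0ℤ)
      A-injective {w} h = ≈-trans (≈-sym (≈-trans (apply-≡mod {A = B ⊗ A} {B = idMat} BA≡1 w) (≗⇒≈ (apply-idMat w))))
        (≈-trans (≗⇒≈ (apply-⊗ B A w)) (≈-trans (IsLinear.≈-cong (apply-linear B) h)
          (≗⇒≈ (λ i → trans (sumFin-cong m (λ k → ℤₚ.*-zeroʳ (B i k))) (sumFin-zero m)))))

      label : Vector m → Fin (q ℕ.^ m)
      label u = funToFin (λ i → residue q (u i))

      label-injective : ∀ {u w} → label u ≡ label w → u ≈[ q ] w
      label-injective {u} {w} eq .at i = residue-≡⇒∣ q (u i) (w i)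
        (trans (sym (Finₚ.finToFun-funToFin (λ i → residue q (u i)) i))
          (trans (cong (λ t → finToFun {q} {m} t i) eq) (Finₚ.finToFun-funToFin (λ i → residue q (w i)) i)))

    exponent-mod-prime : FixesMod A q (L ℕ.* q ℕ.^ m ℕ.* q ℕ.^ m)
    exponent-mod-prime = exponent-bound (modVector m q) (apply A) (IsLinear.≈-cong (apply-linear A))
      (λ u w → ≗⇒≈ (IsLinear.add (apply-linear A) u w)) A-injective q-prime L-mult q-torsion label label-injective

-- Lifting exponents from primes to products.

module Exponents where

  import Data.Integer.Divisibility.Signed as ℤS
  open import Data.List using (List; []; _∷_)
  open import Data.List.Membership.Propositional using (_∈_)
  open import Data.List.Relation.Unary.All as All using (All; []; _∷_)
  open import Data.Nat
  open import Data.Nat.Divisibility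
  open import Data.Nat.ListAction using (product)
  open import Data.Nat.ListAction.Properties using (∈⇒∣product)
  open import Data.Nat.Primality using (Prime)
  open import Data.Nat.Primality.Factorisation using (factorise; PrimeFactorisation)
  open import Data.Nat.Properties
  open import Data.Product using (∃; _×_; _,_)
  open import Relation.Binary.PropositionalEquality
  open import Defs
  open Arithmetic
  open Endomorphisms
  open Matrices
  open _≈[_]_

  ≈-coarsen : ∀ {m K N} {u w : Vector m} → K ∣ N → u ≈[ N ] w → u ≈[ K ] w
  ≈-coarsen K∣N h .at i = ℤS.∣-trans (ℤS.∣ᵤ⇒∣ K∣N) (at h i)

  ≡mod-coarsen : ∀ {m K N} {A B : Mat m} → K ∣ N → A ≡[mod N ] B → A ≡[mod K ] B
  ≡mod-coarsen K∣N h i j = ∣-trans K∣N (h i j)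

  -- This single lifting step serves both exponents: it multiplies the modulus n by p repeatedly,
  -- and it assembles N from its prime factors.
  fixes-lift : ∀ {m} (A : Mat m) {a q k} → FixesMod A a k → FixesMod A q k → FixesMod A (q * a) (q * k)
  fixes-lift A {a} {q} {k} ha hq u = subst (_≈[ q * a ] u) (sym (iter-* (apply A) q k u))
    (iter-lift (iter-linear (apply-linear A) k) ha hq u)

  fixes-lift-^ : ∀ {m} (A : Mat m) {p n K} → p ∣ n → FixesMod A n K → ∀ j → FixesMod A (p ^ j * n) (p ^ j * K)
  fixes-lift-^ A {p} {n} {K} p∣n h zero    = subst₂ (FixesMod A) (sym (*-identityˡ n)) (sym (*-identityˡ K)) h
  fixes-lift-^ A {p} {n} {K} p∣n h (suc j) = subst₂ (FixesMod A) (sym (*-assoc p (p ^ j) n)) (sym (*-assoc p (p ^ j) K))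
    -- Since p ∣ n, the congruence modulo p^j n already contains the one modulo p.
    (fixes-lift A ih (λ u → ≈-coarsen (∣n⇒∣m*n (p ^ j) p∣n) (ih u)))
    where
    ih : FixesMod A (p ^ j * n) (p ^ j * K)
    ih = fixes-lift-^ A p∣n h j

  module _ {m} (A : Mat m) (N D s : ℕ) where

    -- The list may repeat primes, so prime powers need no separate treatment. The exponent N^(s+t)
    -- D works for the new factor and for the remaining product alike, and the factor q caused by
    -- lifting is absorbed in one more N.
    fixes-product : ∀ {qs} → All (λ q → q ∣ N × FixesMod A q (N ^ s * D)) qs →
      ∃ λ t → FixesMod A (product qs) (N ^ t * D)
    fixes-product [] = 0 , λ u → mod λ i → ℤS.∣ᵤ⇒∣ (1∣ _)
    fixes-product {q ∷ qs} ((q∣N , h) ∷ hs) with fixes-product hs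
    ... | t , ih = suc (s + t) , fixes-∣ (product (q ∷ qs)) (subst (q * (N ^ (s + t) * D) ∣_) (sym (*-assoc N (N ^ (s + t)) D)) (*-monoˡ-∣ (N ^ (s + t) * D) q∣N))
        (fixes-lift A
          (fixes-∣ (product qs) (*-monoˡ-∣ D (≤⇒^∣^ N (m≤n+m t s))) ih)
          (fixes-∣ q (*-monoˡ-∣ D (≤⇒^∣^ N (m≤m+n s t))) h))
      where
      fixes-∣ : ∀ M {k l} → k ∣ l → FixesMod A M k → FixesMod A M l
      fixes-∣ = ModAction.fixes-∣ A

    fixes-of-primes : .{{NonZero N}} → (∀ {q} → Prime q → q ∣ N → FixesMod A q (N ^ s * D)) →
      ∃ λ t → FixesMod A N (N ^ t * D)
    fixes-of-primes h = subst (λ M → ∃ λ t → FixesMod A M (N ^ t * D)) (sym isFactorisation)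
      (fixes-product (All.tabulate λ q∈ → ∈⇒∣N q∈ , h (All.lookup factorsPrime q∈) (∈⇒∣N q∈)))
      where
      open PrimeFactorisation (factorise N)
      ∈⇒∣N : ∀ {q} → q ∈ factors → q ∣ N
      ∈⇒∣N q∈ = subst (_ ∣_) (sym isFactorisation) (∈⇒∣product q∈)

-- Combining the two exponents for a P-number.

open import Defs
open import Data.Nat using (ℕ; _≤_; _*_; _^_)
open import Data.Nat.Primality using (Prime)
open import Data.List using (List; [])
open import Data.List.Membership.Propositional using (_∈_)
open import Data.List.Relation.Unary.All using (All)
open import Relation.Binary.PropositionalEquality using (_≢_)
open import Data.Product using (_×_)
open import Data.Empty using (⊥-elim)
import Data.List.Relation.Unary.All as All
open import Data.Nat using (NonZero; suc; _+_; _∸_; >-nonZero; nonTrivial⇒n>1)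
open import Data.Nat.Coprimality using (Coprime)
open import Data.Nat.Divisibility
open import Data.Nat.GCD using (gcd; gcd[m,n]∣m; gcd[m,n]∣n)
open import Data.Nat.Primality using (composite⇒nonTrivial; composite-∣; euclidsLemma; prime⇒irreducible)
open import Data.Nat.Properties
open import Data.Product using (∃; _,_; proj₁; proj₂; map₂)
open import Data.Sum using (inj₁; inj₂)
open import Data.Unit using (tt)
open import Function.Bundles using (mk⇔; module Equivalence)
open import Relation.Binary.PropositionalEquality using (_≡_; refl; sym; trans; cong; subst; module ≡-Reasoning)
open Arithmetic
open Cyclotomics
open Parameters
open Matrices
open Exponents

theorem3p5 : (m : ℕ) → 2 ≤ m → (P : List ℕ) → All Prime P → P ≢ [] →
    (p : ℕ) → p ∈ P → (n : ℕ) → IsPNumber P n → Carmichael m n →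
    IsPNumber P (p ^ vmP m P p * n) × Carmichael m (p ^ vmP m P p * n)
theorem3p5 m _ P P-prime _ p p∈P n (1≤n , n-primes) (n-composite , n-carmichael) =
  (N≥1 , N-primes) , composite-∣ n-composite n∣N , N-carmichael
  where
  v N D : ℕ
  v = vmP m P p
  N = p ^ v * n
  D = DmP'' m P
  p-prime : Prime p
  p-prime = All.lookup P-prime p∈P
  1≤p : 1 ≤ p
  1≤p = <⇒≤ (prime⇒2≤ p-prime)
  2≤n : 2 ≤ n
  2≤n = nonTrivial⇒n>1 n {{composite⇒nonTrivial n-composite}}
  p∣n : p ∣ n
  p∣n = proj₂ (Equivalence.from (n-primes p) p∈P)
  n∣N : n ∣ N
  n∣N = n∣m*n (p ^ v)
  N≥1 : 1 ≤ N
  N≥1 = *-mono-≤ (1≤^ v 1≤p) 1≤n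
  instance
    N≢0 : NonZero N
    N≢0 = >-nonZero N≥1
  2≤N : 2 ≤ N
  2≤N = ≤-trans 2≤n (∣⇒≤ n∣N)
  ∣N⇒∣n : ∀ {q} → Prime q → q ∣ N → q ∣ n
  ∣N⇒∣n pr q∣N with euclidsLemma (p ^ v) n pr q∣N
  ... | inj₁ q∣pᵛ = ∣-trans (prime-∣-^ pr v q∣pᵛ) p∣n
  ... | inj₂ q∣n = q∣n
  N-primes : ∀ q → _
  N-primes q = mk⇔ (λ (pr , q∣N) → Equivalence.to (n-primes q) (pr , ∣N⇒∣n pr q∣N))
                   (λ q∈P → map₂ (λ q∣n → ∣-trans q∣n n∣N) (Equivalence.from (n-primes q) q∈P))

  D-split : ∃ λ s → DmP m P ∣ N ^ s * D
  D-split = stripAll-split P-prime (λ q∈P → ∣-trans (proj₂ (Equivalence.from (n-primes _) q∈P)) n∣N) (DmP m P) (DmP≢0 m P-prime)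
  D∣p^v∸1 : D ∣ p ^ v ∸ 1
  D∣p^v∸1 = multOrder-∣ 1≤p (stripAll-nonzero P-prime (DmP m P) (DmP≢0 m P-prime)) coprime
    where
    coprime : Coprime D p
    coprime (d∣D , d∣p) with prime⇒irreducible p-prime d∣p
    ... | inj₁ d≡1 = d≡1
    ... | inj₂ refl = ⊥-elim (stripAll-∤ P-prime (DmP m P) (DmP≢0 m P-prime) p∈P d∣D)

  module Dₙ = IsLcm (Cyclotomic.Dm-isLcm 2≤n m)
  module D_N = IsLcm (Cyclotomic.Dm-isLcm 2≤N m)

  ∣n∧∣pow∸1⇒≡1 : ∀ {d i} → 1 ≤ i → d ∣ n → d ∣ n ^ i ∸ 1 → d ≡ 1
  ∣n∧∣pow∸1⇒≡1 {d} {i = suc i} _ d∣n d∣ = ∣1⇒≡1 (∣m+n∣m⇒∣n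
    (subst (d ∣_) (sym (m∸n+n≡m (1≤^ (suc i) 1≤n))) (∣m⇒∣m*n (n ^ i) d∣n)) d∣)

  -- By `least` only the numbers n^i - 1 matter. A divisor of n^i - 1 is coprime to n and hence to
  -- p, so if it also divides N = p^v n it divides n and must be 1.
  Dm-coprime-N : ∀ s → gcd (Dm m n) (N ^ s) ≡ 1
  Dm-coprime-N s = ∣1⇒≡1 (Dₙ.least (gcd[m,n]∣m (Dm m n) (N ^ s)) λ {i} 1≤i _ _ → ∣-reflexive
    (∣^∧coprime⇒≡1 (λ d∣z d∣N → coprime 1≤i (∣-trans d∣z (gcd[m,n]∣m _ _)) d∣N) s
      (∣-trans (gcd[m,n]∣n (n ^ i ∸ 1) _) (gcd[m,n]∣n (Dm m n) (N ^ s)))))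
    where
    coprime : ∀ {d i} → 1 ≤ i → d ∣ n ^ i ∸ 1 → d ∣ N → d ≡ 1
    coprime 1≤i d∣ d∣N = ∣n∧∣pow∸1⇒≡1 1≤i
      (coprime-^-∣ (λ (e∣d , e∣p) → ∣n∧∣pow∸1⇒≡1 1≤i (∣-trans e∣p p∣n) (∣-trans e∣d d∣)) v d∣N) d∣

  -- A common divisor z of n^i - 1 and D satisfies N^i = (p^v)^i n^i ≡ 1 (mod z), so z divides N^i -
  -- 1 and thus D_m(N). The distributive form of `least` passes from the single i to the whole gcd.
  gcd∣Dm-N : gcd (Dm m n) D ∣ Dm m N
  gcd∣Dm-N = Dₙ.least (gcd[m,n]∣m (Dm m n) D) λ {i} 1≤i i≤m _ → ∣-trans
    (subst (λ t → gcd (n ^ i ∸ 1) (gcd (Dm m n) D) ∣ t ∸ 1) (sym (^-distribʳ-* i (p ^ v) n))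
      (∣∸1-* ((p ^ v) ^ i) (1≤^ i 1≤n)
        (∣∸1-^ (1≤^ v 1≤p) i (∣-trans (gcd[m,n]∣n (n ^ i ∸ 1) (gcd (Dm m n) D)) (∣-trans (gcd[m,n]∣n (Dm m n) D) D∣p^v∸1)))
        (gcd[m,n]∣m (n ^ i ∸ 1) (gcd (Dm m n) D))))
    (D_N.upper 1≤i i≤m tt)

  gcd∣Km : ∀ t → gcd (p ^ v * Km m n) (N ^ t * D) ∣ Km m N
  gcd∣Km t = ∣-trans
    (∣*∧∣*⇒∣*gcd (N * nabla m n) (Dm m n) D (N ^ t) (Dm-coprime-N t)
      (subst (gcd (p ^ v * Km m n) (N ^ t * D) ∣_) eq (gcd[m,n]∣m (p ^ v * Km m n) (N ^ t * D))) (gcd[m,n]∣n (p ^ v * Km m n) (N ^ t * D)))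
    (*-pres-∣ (*-monoʳ-∣ N (nabla-∣ m n∣N)) gcd∣Dm-N)
    where
    -- The factor p^v gained by lifting is exactly what turns the n inside K(n) into N.
    eq : p ^ v * Km m n ≡ N * nabla m n * Dm m n
    eq = trans (sym (*-assoc (p ^ v) (n * nabla m n) (Dm m n)))
           (cong (_* Dm m n) (sym (*-assoc (p ^ v) n (nabla m n))))

  N-carmichael : ∀ (A : Mat m) → InGL m N A → matPow A (Km m N) ≡[mod N ] idMat
  N-carmichael A (B , AB≡1 , BA≡1) = fixes⇒matPow≡id A (Km m N)
    (ModAction.fixes-∣ A N (gcd∣Km t)
      (ModAction.fixes-gcd A N (p ^ v * Km m n) (N ^ t * D) lifted (proj₂ bounded)))
    where
    lifted : FixesMod A N (p ^ v * Km m n)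
    lifted = fixes-lift-^ A p∣n (matPow≡id⇒fixes A (Km m n)
      (n-carmichael A (B , ≡mod-coarsen {A = A ⊗ B} {B = idMat} n∣N AB≡1 , ≡mod-coarsen {A = B ⊗ A} {B = idMat} n∣N BA≡1))) v
    s : ℕ
    s = proj₁ D-split
    -- The bound modulo q is D_m(q) q^m q^m. Here D_m(q) divides D_m(P), which divides N^s D, and
    -- each q^m divides N^m; this gives an exponent common to all prime divisors of N.
    at-prime : ∀ {q} → Prime q → q ∣ N → FixesMod A q (N ^ (s + m + m) * D)
    at-prime {q} pr q∣N = ModAction.fixes-∣ A q div
      (exponent-mod-prime pr A B (≡mod-coarsen {A = B ⊗ A} {B = idMat} q∣N BA≡1)
        (λ i 1≤i i≤m → IsLcm.upper (Cyclotomic.Dm-isLcm (prime⇒2≤ pr) m) 1≤i i≤m tt))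
      where
      div : Dm m q * q ^ m * q ^ m ∣ N ^ (s + m + m) * D
      div = subst (Dm m q * q ^ m * q ^ m ∣_) eq
        (*-pres-∣ (*-pres-∣ (∣-trans (Dm∣DmP m (Equivalence.to (n-primes q) (pr , ∣N⇒∣n pr q∣N))) (proj₂ D-split))
                            (^-mono-∣ q∣N m)) (^-mono-∣ q∣N m))
        where
        open ≡-Reasoning
        eq : N ^ s * D * N ^ m * N ^ m ≡ N ^ (s + m + m) * D
        eq = begin
          N ^ s * D * N ^ m * N ^ m        ≡⟨ *-assoc (N ^ s * D) (N ^ m) (N ^ m) ⟩
          N ^ s * D * (N ^ m * N ^ m)      ≡⟨ *-assoc (N ^ s) D _ ⟩
          N ^ s * (D * (N ^ m * N ^ m))    ≡⟨ cong (N ^ s *_) (*-comm D _) ⟩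
          N ^ s * (N ^ m * N ^ m * D)      ≡⟨ sym (*-assoc (N ^ s) _ D) ⟩
          N ^ s * (N ^ m * N ^ m) * D      ≡⟨ cong (_* D) (sym (*-assoc (N ^ s) _ _)) ⟩
          N ^ s * N ^ m * N ^ m * D        ≡⟨ cong (λ e → e * N ^ m * D) (sym (^-distribˡ-+-* N s m)) ⟩
          N ^ (s + m) * N ^ m * D          ≡⟨ cong (_* D) (sym (^-distribˡ-+-* N (s + m) m)) ⟩
          N ^ (s + m + m) * D              ∎
    bounded : ∃ λ t → FixesMod A N (N ^ t * D)
    bounded = fixes-of-primes A N D (s + m + m) at-prime
    t : ℕ
    t = proj₁ bounded
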